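{- Let $H$ be a connected bipartite graph with minimum feedback vertex number $1$. Suppose $2k^\ast$ is the length of the shortest cycle contained in $H$. Then $\operatorname{ex}(n,H)=O(n^{1+1/k^\ast})$ as $n\to\infty$, where the implied constant depends only on $H$.
   Context: All graphs are finite and simple. The extremal number $\operatorname{ex}(n,H)$ is the maximum number of edges in a graph on $n$ vertices that contains no (not necessarily induced) subgraph isomorphic to $H$. A feedback vertex set of a graph is a set of vertices whose removal results in an acyclic graph; the minimum feedback vertex number is the minimum size of a feedback vertex set. Thus minimum feedback vertex number $1$ means that the graph contains a cycle and has a single vertex whose removal leaves a forest. -}

module Defs where

open import Data.Bool using (Bool)
open import Data.Fin using (Fin; zero; suc; toℕ; combine; remQuot; finToFun; funToFin)
open import Data.Fin.Properties using (_≟_; _<?_; any?; all?; finToFun-funToFin; remQuot-combine)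
open import Data.Fin.Subset using (Subset; inside; outside; ∣_∣; ∁)
open import Data.List using (List; length; map; filter; allFin; cartesianProduct)
open import Data.List.Extrema.Nat using (max; xs≤max; argmax-sel)
open import Data.List.Membership.Propositional.Properties
  using (∈-map⁺; ∈-map⁻; ∈-filter⁺; ∈-filter⁻; ∈-allFin)
open import Data.List.Properties using (filter-≐)
open import Data.List.Relation.Unary.All as All using ()
open import Data.Nat using (ℕ; suc; _*_; _^_; _≤_; _≥_)
open import Data.Nat.Properties using (n≤0⇒n≡0)
open import Data.Product using (Σ; ∃; ∃-syntax; _×_; _,_; proj₁; proj₂; uncurry)
open import Data.Sum using (inj₁; inj₂)
open import Data.Vec using ([]; _∷_)
open import Function using (id; _∘_)
open import Function.Definitions using (Injective)
open import Level using (0ℓ)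
open import Relation.Binary using (Rel; Symmetric; Irreflexive; Decidable)
open import Relation.Binary.Construct.Closure.ReflexiveTransitive using (Star)
open import Relation.Binary.PropositionalEquality
  using (_≡_; _≢_; refl; sym; trans; cong; subst; subst₂)
open import Relation.Nullary using (¬_; Dec; yes; no; contradiction)
open import Relation.Nullary.Decidable using (map′; ¬?; _×-dec_; _→-dec_)

infix 4 _⊑_ _⊑?_
infixl 5 _─_

record Graph (n : ℕ) : Set₁ where
  infix 4 _~_ _~?_
  field
    _~_      : Rel (Fin n) 0ℓ
    _~?_     : Decidable _~_
    ~-sym    : Symmetric _~_
    ~-irrefl : Irreflexive _≡_ _~_

private
  variable
    h n : ℕ

-- Each edge {u , v} is counted once, through the ordered pair with u < v.
edgeCount : Graph n → ℕ
edgeCount {n} G =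
  length (filter (λ e → (proj₁ e <? proj₂ e) ×-dec (proj₁ e ~? proj₂ e))
                 (cartesianProduct (allFin n) (allFin n)))
  where open Graph G

Connected : Graph n → Set
Connected G = ∀ u v → Star (Graph._~_ G) u v

Bipartite : Graph n → Set
Bipartite {n} G = Σ (Fin n → Bool) λ colour → ∀ u v → u ~ v → colour u ≢ colour v
  where open Graph G

record Cycle (G : Graph n) (ℓ : ℕ) : Set where
  open Graph G
  field
    3≤ℓ       : 3 ≤ ℓ
    vertex    : Fin ℓ → Fin n
    injective : Injective _≡_ _≡_ vertex
    step      : ∀ i j → toℕ j ≡ suc (toℕ i) → vertex i ~ vertex j
    close     : ∀ i j → suc (toℕ i) ≡ ℓ → toℕ j ≡ 0 → vertex i ~ vertex j

Acyclic : Graph n → Set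
Acyclic G = ∀ ℓ → ¬ Cycle G ℓ

ShortestCycleLength : Graph n → ℕ → Set
ShortestCycleLength G ℓ = Cycle G ℓ × (∀ m → Cycle G m → ℓ ≤ m)

-- The increasing enumeration of the elements of S.
elements : (S : Subset n) → Fin ∣ S ∣ → Fin n
elements (inside  ∷ S) zero    = zero
elements (inside  ∷ S) (suc i) = suc (elements S i)
elements (outside ∷ S) i       = suc (elements S i)

-- The subgraph of G induced on the complement of S, its vertices renumbered in
-- increasing order.
_─_ : (G : Graph n) (S : Subset n) → Graph ∣ ∁ S ∣
G ─ S = record
  { _~_      = λ i j → elements (∁ S) i ~ elements (∁ S) j
  ; _~?_     = λ i j → elements (∁ S) i ~? elements (∁ S) j
  ; ~-sym    = ~-sym
  ; ~-irrefl = λ i≡j → ~-irrefl (cong (elements (∁ S)) i≡j)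
  }
  where open Graph G

FeedbackVertexSet : Graph n → Subset n → Set
FeedbackVertexSet G S = Acyclic (G ─ S)

MinFeedbackVertexNumber : Graph n → ℕ → Set
MinFeedbackVertexNumber G m =
  (∃[ S ] FeedbackVertexSet G S × ∣ S ∣ ≡ m) ×
  (∀ S → FeedbackVertexSet G S → m ≤ ∣ S ∣)

-- G contains a not necessarily induced copy of H.
_⊑_ : Graph h → Graph n → Set
_⊑_ {h} {n} H G = Σ (Fin h → Fin n) λ f →
  Injective _≡_ _≡_ f × (∀ u v → Graph._~_ H u v → Graph._~_ G (f u) (f v))

_⊑?_ : (H : Graph h) (G : Graph n) → Dec (H ⊑ G)
_⊑?_ {h} {n} H G = map′ to from (any? copy?)
  where
  module H = Graph H
  module G = Graph G

  Copy : (Fin h → Fin n) → Set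
  Copy f = (∀ u v → f u ≡ f v → u ≡ v) × (∀ u v → u H.~ v → f u G.~ f v)

  copy? : (c : Fin (n ^ h)) → Dec (Copy (finToFun c))
  copy? c =
    all? (λ u → all? λ v → (finToFun c u ≟ finToFun c v) →-dec (u ≟ v)) ×-dec
    all? (λ u → all? λ v → (u H.~? v) →-dec (finToFun c u G.~? finToFun c v))

  to : ∃ (Copy ∘ finToFun) → H ⊑ G
  to (c , inj , hom) = finToFun c , (λ {u} {v} → inj u v) , hom

  from : H ⊑ G → ∃ (Copy ∘ finToFun)
  from (f , inj , hom) = funToFin f
    , (λ u v eq → inj (trans (sym (f≗ u)) (trans eq (f≗ v))))
    , (λ u v e → subst₂ G._~_ (sym (f≗ u)) (sym (f≗ v)) (hom u v e))
    where
    f≗ : ∀ u → finToFun (funToFin f) u ≡ f u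
    f≗ = finToFun-funToFin f

-- A number below 2 ^ (n * n) codes an n × n matrix with entries in Fin 2; u and v
-- are adjacent when they are distinct and both their entries are 1.
decode : Fin (2 ^ (n * n)) → Graph n
decode {n} c = record
  { _~_      = λ u v → u ≢ v × M u v ≡ suc zero × M v u ≡ suc zero
  ; _~?_     = λ u v → ¬? (u ≟ v) ×-dec ((M u v ≟ suc zero) ×-dec (M v u ≟ suc zero))
  ; ~-sym    = λ (u≢v , p , q) → (u≢v ∘ sym) , q , p
  ; ~-irrefl = λ u≡v (u≢v , _) → u≢v u≡v
  }
  where
  M : Fin n → Fin n → Fin 2
  M u v = finToFun c (combine u v)

-- Every graph on Fin n has the same adjacency relation as a member of this list
-- (see decode-encode below).
allGraphs : ∀ n → List (Graph n)
allGraphs n = map decode (allFin (2 ^ (n * n)))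

-- If every graph on n vertices contains H (so H has no edges), the list is empty
-- and ex n H = 0.
ex : ℕ → Graph h → ℕ
ex n H = max 0 (map edgeCount (filter (λ G → ¬? (H ⊑? G)) (allGraphs n)))

SameEdges : Graph n → Graph n → Set
SameEdges G G′ = ∀ u v → (Graph._~_ G u v → Graph._~_ G′ u v) × (Graph._~_ G′ u v → Graph._~_ G u v)

edgeCount-cong : (G G′ : Graph n) → SameEdges G G′ → edgeCount G ≡ edgeCount G′
edgeCount-cong {n} G G′ G≈G′ = cong length
  (filter-≐ (λ e → (proj₁ e <? proj₂ e) ×-dec Graph._~?_ G (proj₁ e) (proj₂ e))
            (λ e → (proj₁ e <? proj₂ e) ×-dec Graph._~?_ G′ (proj₁ e) (proj₂ e))
            ( (λ {e} (u<v , e∈) → u<v , proj₁ (G≈G′ (proj₁ e) (proj₂ e)) e∈)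
            , (λ {e} (u<v , e∈) → u<v , proj₂ (G≈G′ (proj₁ e) (proj₂ e)) e∈))
            (cartesianProduct (allFin n) (allFin n)))

indicator : {A : Set} → Dec A → Fin 2
indicator (yes _) = suc zero
indicator (no  _) = zero

encode : Graph n → Fin (2 ^ (n * n))
encode {n} G = funToFin {n * n} {2} (λ i → indicator (uncurry (Graph._~?_ G) (remQuot n i)))

decode-encode : (G : Graph n) → SameEdges (decode (encode G)) G
decode-encode {n} G u v = to , from
  where
  open Graph G

  M : Fin n → Fin n → Fin 2
  M u v = finToFun (encode G) (combine u v)

  M≡ : ∀ u v → M u v ≡ indicator (u ~? v)
  M≡ u v = trans (finToFun-funToFin {n * n} {2} _ (combine u v))
                 (cong (λ e → indicator (uncurry _~?_ e)) (remQuot-combine u v))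

  M⇒~ : ∀ u v → M u v ≡ suc zero → u ~ v
  M⇒~ u v eq with u ~? v | M≡ u v
  ... | yes e | _  = e
  ... | no  _ | M0 = contradiction (trans (sym M0) eq) λ ()

  ~⇒M : ∀ u v → u ~ v → M u v ≡ suc zero
  ~⇒M u v e with u ~? v | M≡ u v
  ... | yes _ | M1 = M1
  ... | no ¬e | _  = contradiction e ¬e

  to : Graph._~_ (decode (encode G)) u v → u ~ v
  to (_ , p , _) = M⇒~ u v p

  from : u ~ v → Graph._~_ (decode (encode G)) u v
  from e = (λ u≡v → ~-irrefl u≡v e) , ~⇒M u v e , ~⇒M v u (~-sym e)

ex-upper : (H : Graph h) (G : Graph n) → ¬ (H ⊑ G) → edgeCount G ≤ ex n H
ex-upper {n = n} H G free = subst (_≤ ex n H) (edgeCount-cong G′ G (decode-encode G))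
  (All.lookup (xs≤max 0 _)
    (∈-map⁺ edgeCount (∈-filter⁺ (λ G → ¬? (H ⊑? G)) (∈-map⁺ decode (∈-allFin (encode G))) free′)))
  where
  G′ = decode (encode G)

  free′ : ¬ (H ⊑ G′)
  free′ (f , inj , hom) =
    free (f , inj , λ u v e → proj₁ (decode-encode G (f u) (f v)) (hom u v e))

ex-attained : (H : Graph h) → (∃[ G ] ¬ (_⊑_ {n = n} H G)) →
              ∃[ G ] ¬ (_⊑_ {n = n} H G) × edgeCount G ≡ ex n H
ex-attained {n = n} H (G , free)
  with argmax-sel id 0 (map edgeCount (filter (λ G → ¬? (H ⊑? G)) (allGraphs n)))
... | inj₁ ex≡0 = G , free
                , trans (n≤0⇒n≡0 (subst (edgeCount G ≤_) ex≡0 (ex-upper H G free))) (sym ex≡0)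
... | inj₂ ex∈ with ∈-map⁻ edgeCount ex∈
... | G′ , G′∈ , eq =
  G′ , proj₂ (∈-filter⁻ (λ G → ¬? (H ⊑? G)) {xs = allGraphs n} G′∈) , sym eq

-- f n = O(n ^ (p / q)) for q ≥ 1. Both sides of f n ≤ C n ^ (p / q) are raised to
-- the q-th power; a real constant C can be rounded up to a natural number.
_=O[n^_/_] : (ℕ → ℕ) → ℕ → ℕ → Set
f =O[n^ p / q ] = ∃[ C ] ∃[ N ] ∀ n → n ≥ N → f n ^ q ≤ C ^ q * n ^ p

-- Let w be a vertex of H whose removal leaves a forest, and let G be H-free with average degree at
-- least a constant. Walks of G are weighted by the stationary measure of the simple random walk,
-- so no regularity of G is needed, and vertices of degree far below the average are discarded.
-- For ℓ = 1, …, k one finds a set of paths of length ℓ that carries almost all of the weight and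
-- contains boundedly many paths between any two vertices. Given this up to ℓ - 1, call a family
-- of paths of length ℓ robust if, whichever |H| vertices are forbidden, for each path and each i < ℓ
-- some path has the same vertices at positions 0 and i and an allowed vertex at position i + 1, and
-- each path can be replaced by one with the same ends and allowed interior.
-- A nonempty robust family yields a copy of H, because H is bipartite and the cycles
-- through w have length at least 2k ≥ 2ℓ. Hence pruning exhausts all paths of length ℓ: few are
-- lost to the first condition, and the remaining ones meet, in their interior, a set of |H| vertices
-- attached to their two ends, so that they split into shorter paths and are bounded in number.
-- For ℓ = k, the total weight compared with the number n ^ 2 of pairs of ends gives the bound.
module Submission where

open import Data.Bool using (Bool; true; false; not; if_then_else_; T; _∧_)
open import Data.Bool.Properties using (¬-not; not-¬; not-injective; T?; T-∧)
open import Data.Fin using (Fin; zero; suc; toℕ; fromℕ; fromℕ<; inject₁)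
open import Data.Fin.Properties
  using (_≟_; _<?_; any?; toℕ<n; toℕ-fromℕ; toℕ-fromℕ<; toℕ-injective; toℕ-inject₁; toℕ≤pred[n])
open import Data.Fin.Subset using (Subset; inside; outside; ∣_∣; ∁)
open import Data.List
  using (List; []; _∷_; length; map; filter; lookup; take; drop; replicate; allFin; tabulate; _++_;
         _ʳ++_; cartesianProduct; cartesianProductWith; concatMap)
open import Data.List.Extrema.Nat using (argmax-sel)
import Data.List.Membership.DecPropositional as DecMembership
open import Data.List.Membership.Propositional using (_∈_; _∉_; find; lose)
open import Data.List.Membership.Propositional.Properties
open import Data.List.Properties
  using (filter-notAll; length-++; take-take; length-tabulate; length-ʳ++; length-replicate;
         take-all; take++drop≡id; drop-drop; length-take; length-drop)
open import Data.List.Relation.Unary.All as All using (All; []; _∷_)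
open import Data.List.Relation.Unary.All.Properties using (¬Any⇒All¬; ++⁻ˡ)
open import Data.List.Relation.Unary.AllPairs using ([]; _∷_)
open import Data.List.Relation.Unary.Any as Any using (Any; here; there)
open import Data.List.Relation.Unary.Linked using (Linked; []; [-]; _∷_)
import Data.List.Relation.Unary.Unique.DecPropositional as DecUnique
open import Data.List.Relation.Unary.Unique.Propositional using (Unique)
open import Data.List.Relation.Unary.Unique.Propositional.Properties
  using (cartesianProductWith⁺; allFin⁺; filter⁺)
open import Data.Nat
  using (ℕ; zero; suc; _+_; _*_; _∸_; _^_; _!; _≤_; _<_; z≤n; s≤s; _≤ᵇ_; NonZero; >-nonZero;
         ≢-nonZero)
open import Data.Nat.Divisibility using (divides; m≤n⇒m!∣n!; ∣-trans; m∣m*n)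
open import Data.Nat.Properties hiding (_<?_) renaming (_≟_ to _≟ᴺ_)
open import Data.Nat.Solver using (module +-*-Solver)
open import Data.Product using (∃; _×_; _,_; proj₁; proj₂)
open import Data.Product.Properties using (≡-dec)
open import Data.Sum as Sum using (_⊎_; inj₁; inj₂)
open import Data.Unit using (⊤; tt)
open import Data.Vec as Vec using ([]; _∷_)
open import Defs
open import Function using (id; _∘_)
open import Function.Bundles using (Equivalence)
open import Relation.Binary using (DecidableEquality)
open import Relation.Binary.Construct.Closure.ReflexiveTransitive using (Star; ε; _◅_)
open import Relation.Binary.PropositionalEquality
  using (_≡_; _≢_; refl; sym; trans; cong; cong₂; subst; subst₂; module ≡-Reasoning)
open import Relation.Nullary using (¬_; Dec; yes; no; contradiction; does)
open import Relation.Nullary.Decidable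
  using (¬?; _×-dec_; _→-dec_; map′; decidable-stable; dec-true; dec-false)
open +-*-Solver using (solve; _:=_; _:*_; _:+_; con)

-- Nonbacktracking walks and the cycles they contain.

module Walks {h : ℕ} (H : Graph h) where
  open Graph H
  open DecMembership (_≟_ {h}) using (_∈?_)
  open DecUnique (_≟_ {h}) using (unique?)

  infix 4 _≢head_ _heads≢_
  infixr 5 _∷⟨_⟩_

  _≢head_ : Fin h → List (Fin h) → Set
  x ≢head []      = ⊤
  x ≢head (y ∷ _) = x ≢ y

  _heads≢_ : List (Fin h) → List (Fin h) → Set
  []      heads≢ ys = ⊤
  (x ∷ _) heads≢ ys = x ≢head ys

  data NonBacktracking : List (Fin h) → Set where
    [-]    : ∀ {x} → NonBacktracking (x ∷ [])
    _∷⟨_⟩_ : ∀ {x y xs} → x ~ y → x ≢head xs → NonBacktracking (y ∷ xs) →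
             NonBacktracking (x ∷ y ∷ xs)

  -- Two walks out of `c` become one walk through `c`: the first is reversed, and `heads≢` is what
  -- prevents backtracking at the junction.
  join : ∀ {c} xs {ys} → NonBacktracking (c ∷ xs) → NonBacktracking (c ∷ ys) →
         xs heads≢ ys → NonBacktracking (xs ʳ++ (c ∷ ys))
  join []           _                     nbt₂ _ = nbt₂
  join (p ∷ [])     (c~p ∷⟨ _ ⟩ nbt₁)     nbt₂ p≢ = ~-sym c~p ∷⟨ p≢ ⟩ nbt₂
  join (p ∷ q ∷ xs) (c~p ∷⟨ c≢q ⟩ nbt₁)   nbt₂ p≢ =
    join (q ∷ xs) nbt₁ (~-sym c~p ∷⟨ p≢ ⟩ nbt₂) (c≢q ∘ sym)

  nonBacktracking⇒linked : ∀ {xs} → NonBacktracking xs → Linked _~_ xs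
  nonBacktracking⇒linked [-]              = [-]
  nonBacktracking⇒linked (x~y ∷⟨ _ ⟩ nbt) = x~y ∷ nonBacktracking⇒linked nbt

  linked-lookup : ∀ xs {ys} → Linked _~_ (xs ++ ys) →
                  ∀ i j → toℕ j ≡ suc (toℕ i) → lookup xs i ~ lookup xs j
  linked-lookup (_ ∷ _ ∷ _)  (x~y ∷ _) zero    (suc zero) _  = x~y
  linked-lookup (_ ∷ _ ∷ xs) (_ ∷ l)   (suc i) (suc j)    eq = linked-lookup (_ ∷ xs) l i j (suc-injective eq)

  linked-last : ∀ xs {y ys} → Linked _~_ (xs ++ y ∷ ys) →
                ∀ i → suc (toℕ i) ≡ length xs → lookup xs i ~ y
  linked-last (_ ∷ [])     (x~y ∷ _) zero    _  = x~y
  linked-last (_ ∷ _ ∷ xs) (_ ∷ l)   (suc i) eq = linked-last (_ ∷ xs) l i (suc-injective eq)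

  unique-lookup : ∀ {xs : List (Fin h)} → Unique xs → ∀ i j → lookup xs i ≡ lookup xs j → i ≡ j
  unique-lookup (_  ∷ _) zero    zero    _  = refl
  unique-lookup (x≢ ∷ _) zero    (suc j) eq = contradiction eq (All.lookup x≢ (∈-lookup j))
  unique-lookup (x≢ ∷ _) (suc i) zero    eq = contradiction (sym eq) (All.lookup x≢ (∈-lookup i))
  unique-lookup (_  ∷ u) (suc i) (suc j) eq = cong suc (unique-lookup u i j eq)

  unique-before : ∀ xs {y : Fin h} {ys} → Unique (xs ++ y ∷ ys) → All (y ≢_) xs × Unique xs
  unique-before []       _        = [] , []
  unique-before (x ∷ xs) (x≢ ∷ u) =
    let y≢ , uxs = unique-before xs u in
    (All.lookup x≢ (∈-insert xs) ∘ sym) ∷ y≢ , ++⁻ˡ xs x≢ ∷ uxs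

  -- The inequality is strict because a closed walk lists one vertex more than it has edges.
  record CycleWithin (xs : List (Fin h)) : Set where
    constructor cycleWithin
    field
      len     : ℕ
      cycle   : Cycle H len
      shorter : len < length xs
      within  : ∀ i → Cycle.vertex cycle i ∈ xs

  weaken : ∀ {x xs} → CycleWithin xs → CycleWithin (x ∷ xs)
  weaken (cycleWithin m c m< ∈xs) = cycleWithin m c (m≤n⇒m≤1+n m<) (there ∘ ∈xs)

  -- A return after one step would be a loop and after two steps a backtrack, so the part before the
  -- return has at least three vertices and is the cycle.
  firstReturn : ∀ {x} ys {zs} → NonBacktracking (x ∷ ys ++ x ∷ zs) → Unique (ys ++ x ∷ zs) →
                CycleWithin (x ∷ ys ++ x ∷ zs)
  firstReturn []           (x~x ∷⟨ _ ⟩ _)   _ = contradiction x~x (~-irrefl refl)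
  firstReturn (_ ∷ [])     (_ ∷⟨ x≢x ⟩ _)   _ = contradiction refl x≢x
  firstReturn {x} (a ∷ b ∷ ys) {zs} nbt u = cycleWithin (length xs) (record
    { 3≤ℓ       = s≤s (s≤s (s≤s z≤n))
    ; vertex    = lookup xs
    ; injective = λ {i} {j} → unique-lookup (let x≢ , u′ = unique-before (a ∷ b ∷ ys) u in x≢ ∷ u′) i j
    ; step      = linked-lookup xs l
    ; close     = λ { i zero eq _ → linked-last xs l i eq }
    })
    (≤-trans (m<m+n (length xs) (s≤s z≤n)) (≤-reflexive (sym (length-++ xs))))
    (λ i → ∈-++⁺ˡ (∈-lookup {xs = xs} i))
    where
    xs = x ∷ a ∷ b ∷ ys
    l  = nonBacktracking⇒linked nbt

  -- In the shortest suffix with a repetition, the tail is free of repetitions, so the repeated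
  -- vertex is the head.
  nonBacktracking⇒cycle : ∀ {xs} → NonBacktracking xs → ¬ Unique xs → CycleWithin xs
  nonBacktracking⇒cycle [-] ¬u = contradiction ([] ∷ []) ¬u
  nonBacktracking⇒cycle {x ∷ xs} nbt@(_ ∷⟨ _ ⟩ nbt′) ¬u with unique? xs
  ... | no ¬u′ = weaken (nonBacktracking⇒cycle nbt′ ¬u′)
  ... | yes u with x ∈? xs
  ...   | no x∉ = contradiction (¬Any⇒All¬ xs x∉ ∷ u) ¬u
  ...   | yes x∈ with ∈-∃++ x∈
  ...     | ys , zs , eq = subst (CycleWithin ∘ (x ∷_)) (sym eq)
    (firstReturn ys (subst (NonBacktracking ∘ (x ∷_)) eq nbt) (subst Unique eq u))

  closed⇒cycle : ∀ {x xs} → NonBacktracking (x ∷ xs) → x ∈ xs → CycleWithin (x ∷ xs)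
  closed⇒cycle nbt x∈ = nonBacktracking⇒cycle nbt λ { (x≢ ∷ _) → All.lookup x≢ x∈ refl }

-- Feedback vertex sets of size one.

elements-∁ : ∀ {n} (S : Subset n) t → Vec.lookup S t ≡ outside → ∃ λ i → elements (∁ S) i ≡ t
elements-∁ (outside ∷ S) zero    _ = zero , refl
elements-∁ (inside  ∷ S) (suc t) t∉ = let i , eq = elements-∁ S t t∉ in i , cong suc eq
elements-∁ (outside ∷ S) (suc t) t∉ = let i , eq = elements-∁ S t t∉ in suc i , cong suc eq

∣S∣≡0⇒outside : ∀ {n} (S : Subset n) → ∣ S ∣ ≡ 0 → ∀ t → Vec.lookup S t ≡ outside
∣S∣≡0⇒outside (outside ∷ S) _  zero    = refl
∣S∣≡0⇒outside (outside ∷ S) eq (suc t) = ∣S∣≡0⇒outside S eq t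

∣S∣≡1⇒singleton : ∀ {n} (S : Subset n) → ∣ S ∣ ≡ 1 → ∃ λ w → ∀ t → t ≢ w → Vec.lookup S t ≡ outside
∣S∣≡1⇒singleton (inside ∷ S) eq = zero , λ
  { zero    t≢ → contradiction refl t≢
  ; (suc t) _  → ∣S∣≡0⇒outside S (suc-injective eq) t }
∣S∣≡1⇒singleton (outside ∷ S) eq with ∣S∣≡1⇒singleton S eq
... | w , out = suc w , λ
  { zero    _  → refl
  ; (suc t) t≢ → out t (t≢ ∘ cong suc) }

module _ {h : ℕ} (H : Graph h) where

  cycle-─ : ∀ {m} S (c : Cycle H m) → (∀ i → Vec.lookup S (Cycle.vertex c i) ≡ outside) → Cycle (H ─ S) m
  cycle-─ S c out = record
    { 3≤ℓ       = Cycle.3≤ℓ c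
    ; vertex    = index
    ; injective = λ {i} {j} eq → Cycle.injective c
        (trans (sym (index-≡ i)) (trans (cong (elements (∁ S)) eq) (index-≡ j)))
    ; step      = λ i j eq → subst₂ (Graph._~_ H) (sym (index-≡ i)) (sym (index-≡ j)) (Cycle.step c i j eq)
    ; close     = λ i j eq eq′ → subst₂ (Graph._~_ H) (sym (index-≡ i)) (sym (index-≡ j)) (Cycle.close c i j eq eq′)
    }
    where
    index   = λ i → proj₁ (elements-∁ S (Cycle.vertex c i) (out i))
    index-≡ = λ i → proj₂ (elements-∁ S (Cycle.vertex c i) (out i))

  -- A cycle that misses `w` would survive, renumbered, in `H ─ S`.
  feedbackVertex : ∀ {S} → FeedbackVertexSet H S → ∣ S ∣ ≡ 1 →
                   ∃ λ w → ∀ {m} (c : Cycle H m) → ¬ (∀ i → Cycle.vertex c i ≢ w)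
  feedbackVertex {S} acyclic ∣S∣≡1 =
    let w , out = ∣S∣≡1⇒singleton S ∣S∣≡1 in
    w , λ c ≢w → acyclic _ (cycle-─ S c λ i → out _ (≢w i))

-- Robust path families and the greedy embedding of `H`.

record RobustPaths {n : ℕ} (G : Graph n) (ℓ h : ℕ) : Set₁ where
  open Graph G
  field
    Path        : Set
    at          : Path → ℕ → Fin n
    root        : Fin n
    path        : Path
    at-0        : ∀ p → at p 0 ≡ root
    at-step     : ∀ p {i} → i < ℓ → at p i ~ at p (suc i)
    at-distinct : ∀ p {i j} → i < j → j ≤ ℓ → at p i ≢ at p j
    extend      : ∀ p {i} → i < ℓ → (S : Fin h → Fin n) →
                  ∃ λ p′ → at p′ i ≡ at p i × (∀ t → S t ≢ at p′ (suc i))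
    return      : ∀ p → (S : Fin h → Fin n) →
                  ∃ λ p′ → at p′ ℓ ≡ at p ℓ × (∀ {i} → 0 < i → i < ℓ → ∀ t → S t ≢ at p′ i)

flip : ℕ → Bool → Bool
flip zero    b = b
flip (suc i) b = not (flip i b)

module _ {h : ℕ} {A : Set} (f : Fin h → A) (t : Fin h) (a : A) where

  update : Fin h → A
  update s = if does (s ≟ t) then a else f s

  update-same : ∀ {s} → s ≡ t → update s ≡ a
  update-same {s} s≡t with s ≟ t
  ... | yes _   = refl
  ... | no  s≢t = contradiction s≡t s≢t

  update-other : ∀ {s} → s ≢ t → update s ≡ f s
  update-other {s} s≢t with s ≟ t
  ... | yes s≡t = contradiction s≡t s≢t
  ... | no  _   = refl

unique-ʳ++ : ∀ {A : Set} (xs {ys} : List A) → Unique (xs ʳ++ ys) → Unique ys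
unique-ʳ++ []       u = u
unique-ʳ++ (x ∷ xs) u with unique-ʳ++ xs u
... | _ ∷ u′ = u′

unique-ʳ++-disjoint : ∀ {A : Set} (xs {ys} : List A) {z} → Unique (xs ʳ++ ys) → z ∈ xs → z ∉ ys
unique-ʳ++-disjoint (x ∷ xs) u (here refl) z∈ys with unique-ʳ++ xs u
... | z≢ ∷ _ = All.lookup z≢ z∈ys refl
unique-ʳ++-disjoint (x ∷ xs) u (there z∈)  z∈ys = unique-ʳ++-disjoint xs u z∈ (there z∈ys)

-- H is embedded greedily, with w sent to the root. The vertices still to be placed form a list R,
-- and a placed vertex v has a level lam v ≤ ℓ and is sent to the vertex at that level of some path
-- of the family. Levels agree with the distance to w up to ℓ; beyond that they are folded, so that
-- they alternate between ℓ and ℓ - 1.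
module Embedding {h n : ℕ} (H : Graph h) (G : Graph n) (w : Fin h)
  (connected : Connected H) (bipartite : Bipartite H)
  (feedback : ∀ {m} (c : Cycle H m) → ¬ (∀ i → Cycle.vertex c i ≢ w))
  (q : ℕ) (girth : ∀ {m} → Cycle H m → suc (suc q) + suc (suc q) ≤ m)
  (robust : RobustPaths G (suc (suc q)) h) where

  open Graph H
  open Walks H
  open RobustPaths robust
  open DecMembership (_≟_ {h}) using (_∈?_; _∉?_)
  private module G = Graph G

  ℓ : ℕ
  ℓ = suc (suc q)

  colour : Fin h → Bool
  colour = proj₁ bipartite

  colour-~ : ∀ {u v} → u ~ v → colour u ≡ not (colour v)
  colour-~ u~v = ¬-not (proj₂ bipartite _ _ u~v)

  private variable
    R R′ : List (Fin h)
    a b c p s t v z : Fin h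
    m : ℕ

  -- Out R p c m z: a nonbacktracking walk with m edges from c to z, entered from p, whose
  -- interior lies in R.
  data Out (R : List (Fin h)) (p c : Fin h) : ℕ → Fin h → Set where
    arrive : c ~ z → p ≢ z → Out R p c 1 z
    via : c ~ t → p ≢ t → t ∈ R → Out R c t m z → Out R p c (suc m) z

  out-⊆ : (∀ {t} → t ∈ R → t ∈ R′) → Out R p c m z → Out R′ p c m z
  out-⊆ R⊆ (arrive c~z p≢z)       = arrive c~z p≢z
  out-⊆ R⊆ (via c~t p≢t t∈ o) = via c~t p≢t (R⊆ t∈) (out-⊆ R⊆ o)

  -- The vertex before `t` lies in `R` and `v` does not, so the added step does not backtrack.
  out-snoc : c ∈ R → Out R p c m t → t ∈ R → t ~ v → v ∉ R → Out R p c (suc m) v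
  out-snoc c∈ (arrive c~t p≢t)        t∈ t~v v∉ = via c~t p≢t t∈ (arrive t~v λ { refl → v∉ c∈ })
  out-snoc c∈ (via c~s p≢s s∈ o) t∈ t~v v∉ = via c~s p≢s s∈ (out-snoc s∈ o t∈ t~v v∉)

  out? : ∀ R p c m z → Dec (Out R p c m z)
  out? R p c zero    z = no λ ()
  out? R p c (suc m) z with any? (λ t → (c ~? t) ×-dec (¬? (p ≟ t) ×-dec ((t ∈? R) ×-dec out? R c t m z)))
  ... | yes (t , c~t , p≢t , t∈ , o) = yes (via c~t p≢t t∈ o)
  ... | no ¬step with m ≟ᴺ 0
  ...   | no m≢0 = no λ
    { (arrive _ _) → m≢0 refl
    ; (via c~t p≢t t∈ o) → ¬step (_ , c~t , p≢t , t∈ , o) }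
  ...   | yes refl = map′ (λ (c~z , p≢z) → arrive c~z p≢z)
    (λ { (arrive c~z p≢z) → c~z , p≢z
       ; (via c~t p≢t t∈ o) → contradiction (_ , c~t , p≢t , t∈ , o) ¬step })
    ((c ~? z) ×-dec ¬? (p ≟ z))

  out-colour : Out R p c m z → colour c ≡ flip m (colour z)
  out-colour (arrive c~z _)     = colour-~ c~z
  out-colour (via c~t _ _ o) = trans (colour-~ c~t) (cong not (out-colour o))

  out-list : Out R p c m z → ∃ λ xs → NonBacktracking (c ∷ xs) × p ≢head xs × length xs ≡ m × z ∈ xs ×
             (∀ {y} → y ∈ xs → y ∈ R ⊎ y ≡ z)
  out-list (arrive c~z p≢z) = _ ∷ [] , c~z ∷⟨ tt ⟩ [-] , p≢z , refl , here refl , λ { (here y≡z) → inj₂ y≡z }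
  out-list (via c~t p≢t t∈ o) =
    let xs , nbt , c≢ , len , z∈ , ⊆R = out-list o in
    _ ∷ xs , c~t ∷⟨ c≢ ⟩ nbt , p≢t , cong suc len , there z∈ ,
    λ { (here refl) → inj₁ t∈ ; (there y∈) → ⊆R y∈ }

  -- A closed nonbacktracking walk contains a cycle no longer than itself.
  closedOut-girth : w ∉ R → w ~ t → t ∈ R → Out R w t m w → ℓ + ℓ ≤ suc m
  closedOut-girth w∉ w~t t∈ o =
    let xs , nbt , w≢ , len , w∈ , _ = out-list o
        cycleWithin _ c short _ = closed⇒cycle (w~t ∷⟨ w≢ ⟩ nbt) (there w∈)
    in ≤-trans (girth c) (≤-trans (≤-pred short) (s≤s (≤-reflexive len)))

  -- Every vertex of such a closed walk lies in `R`, so it would contain a cycle that misses `w`.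
  closedOut-feedback : w ∉ R → c ∈ R → c ~ t → t ∈ R → ¬ Out R c t m c
  closedOut-feedback {R = R} w∉ c∈ c~t t∈ o =
    let xs , nbt , c≢ , _ , z∈ , ⊆R = out-list o
        cycleWithin _ cyc _ within = closed⇒cycle (c~t ∷⟨ c≢ ⟩ nbt) (there z∈)
    in feedback cyc λ i eq → w∉ (⊆-all ⊆R (subst (_∈ _) eq (within i)))
    where
    ⊆-all : ∀ {xs} → (∀ {y} → y ∈ xs → y ∈ R ⊎ y ≡ _) → ∀ {y} → y ∈ _ ∷ _ ∷ xs → y ∈ R
    ⊆-all ⊆R (here refl)         = c∈
    ⊆-all ⊆R (there (here refl)) = t∈
    ⊆-all ⊆R (there (there y∈)) with ⊆R y∈
    ... | inj₁ y∈R  = y∈R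
    ... | inj₂ refl = c∈

  -- The two walks leave `c` by different edges, since `t` is in `R` and `d` is not. Glued at `c`
  -- they visit `w` twice, so they contain a cycle no longer than both together.
  join-girth : ∀ {ds d} → w ∉ R → NonBacktracking (c ∷ d ∷ ds) → w ∈ d ∷ ds → d ∉ R →
               c ~ t → t ∈ R → Out R c t m w → ℓ + ℓ ≤ length (d ∷ ds) + suc m
  join-girth {c = c} {t = t} {ds = ds} {d} w∉ nbt w∈ d∉ c~t t∈ o =
    let xs , nbt′ , c≢ , len , w∈xs , _ = out-list o
        cycleWithin _ cyc short _ = nonBacktracking⇒cycle
          (join (d ∷ ds) nbt (c~t ∷⟨ c≢ ⟩ nbt′) λ { refl → d∉ t∈ })
          λ u → unique-ʳ++-disjoint (d ∷ ds) u w∈ (there (there w∈xs))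
    in ≤-trans (girth cyc) (≤-pred (≤-trans short (≤-reflexive (begin
      length ((d ∷ ds) ʳ++ (c ∷ t ∷ xs))     ≡⟨ length-ʳ++ (d ∷ ds) ⟩
      length (d ∷ ds) + suc (suc (length xs)) ≡⟨ cong (λ k → length (d ∷ ds) + suc (suc k)) len ⟩
      length (d ∷ ds) + suc (suc _)           ≡⟨ +-suc (length (d ∷ ds)) _ ⟩
      suc (length (d ∷ ds) + suc _)           ∎))))
    where open ≡-Reasoning

  remove : Fin h → List (Fin h) → List (Fin h)
  remove t = filter (λ s → ¬? (s ≟ t))

  remove-⊆ : s ∈ remove t R → s ∈ R
  remove-⊆ {t = t} {R = R} s∈ = proj₁ (∈-filter⁻ (λ s → ¬? (s ≟ t)) {xs = R} s∈)

  ∈-remove : s ∈ R → s ≢ t → s ∈ remove t R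
  ∈-remove {t = t} = ∈-filter⁺ (λ s → ¬? (s ≟ t))

  ∉-remove-self : t ∉ remove t R
  ∉-remove-self {t = t} {R = R} t∈ = proj₂ (∈-filter⁻ (λ s → ¬? (s ≟ t)) {xs = R} t∈) refl

  ∉-remove : s ∉ R → s ∉ remove t R
  ∉-remove s∉ s∈ = s∉ (remove-⊆ s∈)

  length-remove : t ∈ R → length (remove t R) < length R
  length-remove {t = t} t∈ = filter-notAll (λ s → ¬? (s ≟ t)) _ (Any.map (λ { refl ¬≡ → ¬≡ refl }) t∈)

  ∉-remove⁻ : s ∉ remove t R → s ≡ t ⊎ (s ≢ t × s ∉ R)
  ∉-remove⁻ {s = s} {t = t} s∉ with s ≟ t
  ... | yes s≡t = inj₁ s≡t
  ... | no  s≢t = inj₂ (s≢t , λ s∈ → s∉ (∈-remove s∈ s≢t))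

  -- The second alternative cuts the walk at its first visit to `t`.
  out-remove : Out R p c m z → Out (remove t R) p c m z ⊎ ∃ λ m′ → Out R p c m′ t
  out-remove (arrive c~z p≢z) = inj₁ (arrive c~z p≢z)
  out-remove {t = t} (via {t = s} c~s p≢s s∈ o) with s ≟ t
  ... | yes refl = inj₂ (1 , arrive c~s p≢s)
  ... | no  s≢t with out-remove {t = t} o
  ...   | inj₁ o′       = inj₁ (via c~s p≢s (∈-remove s∈ s≢t) o′)
  ...   | inj₂ (_ , o′) = inj₂ (_ , via c~s p≢s s∈ o′)

  -- No two placed vertices other than w are joined through R, so that each new vertex has at most
  -- one placed neighbour other than w.
  Separated : List (Fin h) → Set
  Separated R = ∀ {a b t m} → a ∉ R → a ≢ w → b ∉ R → b ≢ w → a ~ t → t ∈ R → ¬ Out R a t m b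

  -- A walk that starts or ends at the newly placed `t` is prolonged along the edge `v ~ t` and then
  -- joins vertices placed earlier.
  separated-attach : Separated R → v ∉ R → v ≢ w → v ~ t → t ∈ R → Separated (remove t R)
  separated-attach {R = R} {v = v} {t = t} sep v∉ v≢w v~t t∈ a∉ a≢w b∉ b≢w a~s s∈ o =
    let a′ , a′∉ , a′≢w , _ , _ , a′~s , s∈′ , o′  = front (∉-remove⁻ a∉)
        b′ , b′∉ , b′≢w , _ , o″ = back s∈′ o′ b≢w (∉-remove⁻ b∉)
    in sep a′∉ a′≢w b′∉ b′≢w a′~s s∈′ o″
    where
    o₀ = out-⊆ remove-⊆ o
    s∈R = remove-⊆ s∈

    front : _ ≡ t ⊎ (_ ≢ t × _ ∉ R) →
            ∃ λ a′ → a′ ∉ R × a′ ≢ w × ∃ λ s′ → ∃ λ m′ → a′ ~ s′ × s′ ∈ R × Out R a′ s′ m′ _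
    front (inj₁ refl)      = v , v∉ , v≢w , _ , _ , v~t , t∈ , via a~s (λ { refl → v∉ s∈R }) s∈R o₀
    front (inj₂ (_ , a∉R)) = _ , a∉R , a≢w , _ , _ , a~s , s∈R , o₀

    back : ∀ {a′ s′ m′ b} → s′ ∈ R → Out R a′ s′ m′ b → b ≢ w → b ≡ t ⊎ (b ≢ t × b ∉ R) →
           ∃ λ b′ → b′ ∉ R × b′ ≢ w × ∃ λ m″ → Out R a′ s′ m″ b′
    back s′∈ o′ _   (inj₁ refl)      = v , v∉ , v≢w , _ , out-snoc s′∈ o′ t∈ (~-sym v~t) v∉
    back s′∈ o′ b≢w (inj₂ (_ , b∉R)) = _ , b∉R , b≢w , _ , o′

  -- A vertex is placed when it lies outside `rest`; on `rest` the values of `lam` and `f` are junk.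
  record State : Set where
    field
      rest      : List (Fin h)
      lam       : Fin h → ℕ
      f         : Fin h → Fin n
      w∉        : w ∉ rest
      lam-w     : lam w ≡ 0
      f-w       : f w ≡ root
      witness   : v ∉ rest → ∃ λ p → at p (lam v) ≡ f v
      lam≤      : v ∉ rest → lam v ≤ ℓ
      parity    : v ∉ rest → colour v ≡ flip (lam v) (colour w)
      injective : a ∉ rest → b ∉ rest → f a ≡ f b → a ≡ b
      hom       : a ∉ rest → b ∉ rest → a ~ b → f a G.~ f b
      separated : Separated rest

  open State

  -- From a placed v, reaching w through R takes long enough that levels can first rise to ℓ and
  -- then fall to 0.
  Deep : State → Fin h → Set
  Deep σ v = ∀ {t m} → v ~ t → t ∈ rest σ → Out (rest σ) v t m w → ℓ + ℓ ≤ lam σ v + suc m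

  module Add (σ : State) (t∈ : t ∈ rest σ) (i : ℕ) (y : Fin n)
    (i≤ℓ : i ≤ ℓ) (at-y : ∃ λ p → at p i ≡ y) (parity-t : colour t ≡ flip i (colour w))
    (fresh : ∀ {u} → u ∉ rest σ → f σ u ≢ y)
    (hom-t : ∀ {u} → u ∉ rest σ → u ~ t → f σ u G.~ y)
    (separated′ : Separated (remove t (rest σ))) where

    lam′ = update (lam σ) t i
    f′   = update (f σ) t y

    lam-other : v ∉ rest σ → lam′ v ≡ lam σ v
    lam-other v∉ = update-other (lam σ) t i λ { refl → v∉ t∈ }

    f-other : v ∉ rest σ → f′ v ≡ f σ v
    f-other v∉ = update-other (f σ) t y λ { refl → v∉ t∈ }

    lam-t : lam′ t ≡ i
    lam-t = update-same (lam σ) t i refl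

    f-t : f′ t ≡ y
    f-t = update-same (f σ) t y refl

    state : State
    state = record
      { rest      = remove t (rest σ)
      ; lam       = lam′
      ; f         = f′
      ; w∉        = ∉-remove (w∉ σ)
      ; lam-w     = trans (lam-other (w∉ σ)) (lam-w σ)
      ; f-w       = trans (f-other (w∉ σ)) (f-w σ)
      ; witness   = λ v∉ → witness′ (∉-remove⁻ v∉)
      ; lam≤      = λ v∉ → lam≤′ (∉-remove⁻ v∉)
      ; parity    = λ v∉ → parity′ (∉-remove⁻ v∉)
      ; injective = λ a∉ b∉ → injective′ (∉-remove⁻ a∉) (∉-remove⁻ b∉)
      ; hom       = λ a∉ b∉ → hom′ (∉-remove⁻ a∉) (∉-remove⁻ b∉)
      ; separated = separated′
      }
      where
      Placed : Fin h → Set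
      Placed v = v ≡ t ⊎ (v ≢ t × v ∉ rest σ)

      witness′ : Placed v → ∃ λ p → at p (lam′ v) ≡ f′ v
      witness′ (inj₁ refl) = let p , eq = at-y in p , trans (cong (at p) lam-t) (trans eq (sym f-t))
      witness′ (inj₂ (_ , v∉)) = let p , eq = witness σ v∉ in
        p , trans (cong (at p) (lam-other v∉)) (trans eq (sym (f-other v∉)))

      lam≤′ : Placed v → lam′ v ≤ ℓ
      lam≤′ (inj₁ refl)     = subst (_≤ ℓ) (sym lam-t) i≤ℓ
      lam≤′ (inj₂ (_ , v∉)) = subst (_≤ ℓ) (sym (lam-other v∉)) (lam≤ σ v∉)

      parity′ : Placed v → colour v ≡ flip (lam′ v) (colour w)
      parity′ (inj₁ refl)     = trans parity-t (cong (λ j → flip j (colour w)) (sym lam-t))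
      parity′ (inj₂ (_ , v∉)) = trans (parity σ v∉) (cong (λ j → flip j (colour w)) (sym (lam-other v∉)))

      injective′ : Placed a → Placed b → f′ a ≡ f′ b → a ≡ b
      injective′ (inj₁ refl)     (inj₁ refl)     eq = refl
      injective′ (inj₁ refl)     (inj₂ (_ , b∉)) eq =
        contradiction (trans (sym (f-other b∉)) (trans (sym eq) f-t)) (fresh b∉)
      injective′ (inj₂ (_ , a∉)) (inj₁ refl)     eq =
        contradiction (trans (sym (f-other a∉)) (trans eq f-t)) (fresh a∉)
      injective′ (inj₂ (_ , a∉)) (inj₂ (_ , b∉)) eq =
        injective σ a∉ b∉ (trans (sym (f-other a∉)) (trans eq (f-other b∉)))

      hom′ : Placed a → Placed b → a ~ b → f′ a G.~ f′ b
      hom′ (inj₁ refl)     (inj₁ refl)     a~b = contradiction a~b (~-irrefl refl)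
      hom′ (inj₁ refl)     (inj₂ (_ , b∉)) a~b =
        subst₂ G._~_ (sym f-t) (sym (f-other b∉)) (G.~-sym (hom-t b∉ (~-sym a~b)))
      hom′ (inj₂ (_ , a∉)) (inj₁ refl)     a~b =
        subst₂ G._~_ (sym (f-other a∉)) (sym f-t) (hom-t a∉ a~b)
      hom′ (inj₂ (_ , a∉)) (inj₂ (_ , b∉)) a~b =
        subst₂ G._~_ (sym (f-other a∉)) (sym (f-other b∉)) (hom σ a∉ b∉ a~b)

    deep-old : v ∉ rest σ → Deep σ v → Deep state v
    deep-old v∉ deep v~s s∈ o =
      subst (λ j → ℓ + ℓ ≤ j + suc _) (sym (lam-other v∉)) (deep v~s (remove-⊆ s∈) (out-⊆ remove-⊆ o))

  -- The first alternative of `deep` marks the vertices whose depth is to be inherited from `σ`; for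
  -- `c` and the newly placed vertices depth is established afresh.
  record Extension (σ : State) (c : Fin h) : Set where
    field
      state′  : State
      rest-⊆  : s ∈ rest state′ → s ∈ rest σ
      rest-<  : length (rest state′) < length (rest σ)
      lam-≡   : v ∉ rest σ → lam state′ v ≡ lam σ v
      deep    : v ∉ rest state′ → (v ∉ rest σ × v ≢ c) ⊎ Deep state′ v

  -- The walk from `c` through `t` to `w` has as many edges as the level of `c`, so it can be laid
  -- along `p` down to the root, one vertex per recursive call.
  placePath : ∀ j (σ : State) {c t} p → c ∉ rest σ → c ≢ w → lam σ c ≡ suc (suc j) →
    at p (suc (suc j)) ≡ f σ c →
    (∀ {i} → 0 < i → i < suc (suc j) → ∀ {u} → u ∉ rest σ → f σ u ≢ at p i) →
    c ~ t → t ∈ rest σ → Out (rest σ) c t (suc j) w →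
    (∀ {s m} → c ~ s → s ∈ rest σ → Out (rest σ) c s m w → suc j ≤ m) →
    Extension σ c
  placePath j σ {c} {t} p c∉ c≢w lam-c at-c fresh c~t t∈ o shortest = continue j refl o₁
    where
    R₀ = rest σ

    j<ℓ : suc j < ℓ
    j<ℓ = subst (_≤ ℓ) lam-c (lam≤ σ c∉)

    at~ : f σ c G.~ at p (suc j)
    at~ = subst (G._~ at p (suc j)) at-c (G.~-sym (at-step p j<ℓ))

    hom-t : ∀ {u} → u ∉ R₀ → u ~ t → f σ u G.~ at p (suc j)
    hom-t {u} u∉ u~t with u ≟ c | u ≟ w
    ... | yes refl | _        = at~
    ... | no  u≢c  | no u≢w   = contradiction (arrive (~-sym u~t) (u≢c ∘ sym)) (separated σ c∉ c≢w u∉ u≢w c~t t∈)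
    -- An edge from `w` to `t` forces `j` to be 0 by minimality of the walk, and position 1 of `p`
    -- is adjacent to the root.
    ... | no  u≢c  | yes refl with shortest c~t t∈ (arrive (~-sym u~t) c≢w)
    ...   | s≤s z≤n = subst (G._~ at p 1) (trans (at-0 p) (sym (f-w σ))) (at-step p (s≤s z≤n))

    parity-t : colour t ≡ flip (suc j) (colour w)
    parity-t = out-colour o

    open Add σ t∈ (suc j) (at p (suc j)) (<⇒≤ j<ℓ) (p , refl) parity-t
      (fresh (s≤s z≤n) ≤-refl) hom-t (separated-attach (separated σ) c∉ c≢w c~t t∈)

    o₁ : Out (remove t R₀) c t (suc j) w
    -- A second visit to `t` would give a closed walk at `c`, which `Separated` also excludes
    -- because its two ends may coincide.
    o₁ with out-remove {t = t} o
    ... | inj₁ o′       = o′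
    ... | inj₂ (_ , o′) = contradiction (out-snoc t∈ o′ t∈ (~-sym c~t) c∉) (separated σ c∉ c≢w c∉ c≢w c~t t∈)

    t≢w : t ≢ w
    t≢w refl = w∉ σ t∈

    -- The walk being placed has length `lam σ c`; any other walk from `c` to `w` closes it up to a
    -- cycle, so the girth gives the depth.
    deep-c : ∀ σ′ → (∀ {s} → s ∈ rest σ′ → s ∈ remove t R₀) → lam σ′ c ≡ lam σ c → Deep σ′ c
    deep-c σ′ R′⊆ lam≡ c~s s∈ o′ =
      let ds , nbt , c≢ , len , w∈ , _ = out-list o in
      subst (λ k → ℓ + ℓ ≤ k + suc _) (trans (cong suc len) (sym (trans lam≡ lam-c)))
        (join-girth (w∉ σ′) (c~t ∷⟨ c≢ ⟩ nbt) (there w∈) (λ t∈′ → ∉-remove-self {t = t} {R = R₀} (R′⊆ t∈′)) c~s s∈ o′)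

    continue : ∀ j′ → j′ ≡ j → Out (remove t R₀) c t (suc j′) w → Extension σ c
    continue zero refl (arrive t~w c≢w′) = record
      { state′ = state
      ; rest-⊆ = remove-⊆ {t = t} {R = R₀}
      ; rest-< = length-remove t∈
      ; lam-≡  = lam-other
      ; deep   = λ v∉ → deep′ (∉-remove⁻ {t = t} {R = R₀} v∉)
      }
      where
      deep-t : Deep state t
      deep-t t~s s∈ o′ = subst (λ k → ℓ + ℓ ≤ k + suc _) (sym lam-t)
        (join-girth (w∉ state) (t~w ∷⟨ tt ⟩ [-]) (here refl) (w∉ state) t~s s∈ o′)

      deep′ : v ≡ t ⊎ (v ≢ t × v ∉ R₀) → (v ∉ R₀ × v ≢ c) ⊎ Deep state v
      deep′ (inj₁ refl) = inj₂ deep-t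
      deep′ {v} (inj₂ (_ , v∉)) with v ≟ c
      ... | yes refl = inj₂ (deep-c state id (lam-other c∉))
      ... | no  v≢c  = inj₁ (v∉ , v≢c)
    continue (suc j′) refl (via t~s c≢s s∈ o′) = record
      { state′ = E.state′
      ; rest-⊆ = remove-⊆ {t = t} {R = R₀} ∘ E.rest-⊆
      ; rest-< = <-trans E.rest-< (length-remove t∈)
      ; lam-≡  = λ v∉ → trans (E.lam-≡ (∉-remove v∉)) (lam-other v∉)
      ; deep   = λ v∉ → deep′ (E.deep v∉)
      }
      where
      fresh′ : ∀ {i} → 0 < i → i < suc (suc j′) → ∀ {u} → u ∉ remove t R₀ → f state u ≢ at p i
      fresh′ 0<i i<j u∉ with ∉-remove⁻ {t = t} {R = R₀} u∉
      ... | inj₁ refl      = λ eq → at-distinct p i<j (<⇒≤ j<ℓ) (trans (sym eq) f-t)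
      ... | inj₂ (_ , u∉R₀) = λ eq → fresh 0<i (m<n⇒m<1+n i<j) u∉R₀ (trans (sym (f-other u∉R₀)) eq)

      shortest′ : ∀ {s m} → t ~ s → s ∈ rest state → Out (rest state) t s m w → suc j′ ≤ m
      shortest′ t~s s∈ o = ≤-pred (shortest c~t t∈
        (via t~s (λ { refl → c∉ (remove-⊆ {t = t} {R = R₀} s∈) }) (remove-⊆ {t = t} {R = R₀} s∈)
          (out-⊆ (remove-⊆ {t = t} {R = R₀}) o)))

      extension : Extension state t
      extension = placePath j′ state p (∉-remove-self {t = t} {R = R₀}) t≢w lam-t (sym f-t) fresh′ t~s s∈ o′ shortest′

      module E = Extension extension

      deep′ : (v ∉ remove t R₀ × v ≢ t) ⊎ Deep E.state′ v → (v ∉ R₀ × v ≢ c) ⊎ Deep E.state′ v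
      deep′ (inj₂ deep) = inj₂ deep
      deep′ {v} (inj₁ (v∉ , v≢t)) with v ≟ c | ∉-remove⁻ {t = t} {R = R₀} v∉
      ... | yes refl | _              = inj₂ (deep-c E.state′ E.rest-⊆ (trans (E.lam-≡ (∉-remove c∉)) (lam-other c∉)))
      ... | no  _    | inj₁ v≡t       = contradiction v≡t v≢t
      ... | no  v≢c  | inj₂ (_ , v∉R₀) = inj₁ (v∉R₀ , v≢c)

  record Progress (σ : State) : Set where
    field
      state′ : State
      rest-< : length (rest state′) < length (rest σ)
      deep   : v ∉ rest state′ → Deep state′ v

  -- Depth passes from `v` to `t`: the level rises by one, and a walk from `t` to `w` is one edge
  -- shorter than its prolongation to `v`.
  up : (σ : State) → (∀ {v} → v ∉ rest σ → Deep σ v) → v ∉ rest σ → t ∈ rest σ → v ~ t → lam σ v < ℓ →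
       (∀ {u} → u ∉ rest σ → u ~ t → u ≡ v) → Separated (remove t (rest σ)) → Progress σ
  up {v} {t} σ deep v∉ t∈ v~t lam<ℓ only sep with witness σ v∉
  ... | p , at-v with extend p lam<ℓ (f σ)
  ...   | p′ , at≡ , fresh = record
    { state′ = state
    ; rest-< = length-remove t∈
    ; deep   = λ u∉ → deep′ (∉-remove⁻ {t = t} {R = rest σ} u∉)
    }
    where
    hom-t : ∀ {u} → u ∉ rest σ → u ~ t → f σ u G.~ at p′ (suc (lam σ v))
    hom-t u∉ u~t with refl ← only u∉ u~t = subst (G._~ _) (trans at≡ at-v) (at-step p′ lam<ℓ)

    fresh-t : ∀ {u} → u ∉ rest σ → f σ u ≢ at p′ (suc (lam σ v))
    fresh-t {u} _ = fresh u

    open Add σ t∈ (suc (lam σ v)) (at p′ (suc (lam σ v))) lam<ℓ (p′ , refl)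
      (trans (colour-~ (~-sym v~t)) (cong not (parity σ v∉))) fresh-t hom-t sep

    deep′ : ∀ {u} → u ≡ t ⊎ (u ≢ t × u ∉ rest σ) → Deep state u
    deep′ (inj₂ (_ , u∉)) = deep-old u∉ (deep u∉)
    deep′ (inj₁ refl) {m = m} t~s s∈ o = subst (ℓ + ℓ ≤_)
      (trans (+-suc (lam σ v) (suc m)) (cong (_+ suc m) (sym lam-t)))
      (deep v∉ v~t t∈ (via t~s (λ { refl → v∉ (remove-⊆ s∈) }) (remove-⊆ s∈) (out-⊆ remove-⊆ o)))

  -- Below level `ℓ`, `t` goes one level above `v`. At level `ℓ`, either a walk of length `ℓ` leads
  -- from `v` through `t` to `w` and is placed as a whole, or `t` is folded down.
  module Attach (σ : State) (deep : ∀ {v} → v ∉ rest σ → Deep σ v) {v t}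
    (v∉ : v ∉ rest σ) (v≢w : v ≢ w) (t∈ : t ∈ rest σ) (v~t : v ~ t) where

    sep : Separated (remove t (rest σ))
    sep = separated-attach (separated σ) v∉ v≢w v~t t∈

    only : ¬ w ~ t → ∀ {u} → u ∉ rest σ → u ~ t → u ≡ v
    only w≁t {u} u∉ u~t with u ≟ v | u ≟ w
    ... | yes u≡v | _        = u≡v
    ... | no  _   | yes refl = contradiction u~t w≁t
    ... | no  u≢v | no  u≢w  =
      contradiction (arrive (~-sym u~t) (u≢v ∘ sym)) (separated σ v∉ v≢w u∉ u≢w v~t t∈)

    attachUp : lam σ v < ℓ → Progress σ
    attachUp lam<ℓ = up σ deep v∉ t∈ v~t lam<ℓ (only w≁t) sep
      where
      -- An edge `w ~ t` would give a walk of length 2 from `v` to `w`, too short for the depth of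
      -- `v`.
      w≁t : ¬ w ~ t
      w≁t w~t = <-irrefl refl (begin-strict
        lam σ v + 2   <⟨ +-monoˡ-< 2 lam<ℓ ⟩
        ℓ + 2         ≤⟨ +-monoʳ-≤ ℓ (s≤s (s≤s z≤n)) ⟩
        ℓ + ℓ         ≤⟨ deep v∉ v~t t∈ (arrive (~-sym w~t) v≢w) ⟩
        lam σ v + 2   ∎)
        where open ≤-Reasoning

    -- t is folded down to level ℓ - 1; the parity of the levels rules out walks of length ℓ + 1.
    attachFold : lam σ v ≡ ℓ → ¬ Out (rest σ) v t (suc q) w → Progress σ
    attachFold lam≡ ¬short with witness σ v∉
    ... | p , at-v with return p (f σ)
    ...   | p′ , at≡ , fresh = record
      { state′ = state
      ; rest-< = length-remove t∈
      ; deep   = λ u∉ → deep′ (∉-remove⁻ {t = t} {R = rest σ} u∉)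
      }
      where
      t-colour : colour t ≡ flip (suc q) (colour w)
      t-colour = not-injective (trans (sym (colour-~ v~t)) (trans (parity σ v∉) (cong (λ i → flip i (colour w)) lam≡)))

      far : ∀ {m} → Out (rest σ) v t m w → ℓ < m
      far {m} o with m ≟ᴺ suc q | m ≟ᴺ ℓ
      ... | yes refl | _        = contradiction o ¬short
      ... | no  _    | yes refl = contradiction (trans (sym t-colour) (out-colour o)) (not-¬ refl)
      ... | no  m≢q  | no  m≢ℓ  = ≤∧≢⇒< (≤∧≢⇒< (≤-pred ℓ≤1+m) (m≢q ∘ sym)) (m≢ℓ ∘ sym)
        where
        ℓ≤1+m : ℓ ≤ suc m
        ℓ≤1+m = +-cancelˡ-≤ ℓ ℓ (suc m) (subst (λ i → ℓ + ℓ ≤ i + suc m) lam≡ (deep v∉ v~t t∈ o))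

      w≁t : ¬ w ~ t
      w≁t w~t with far (arrive (~-sym w~t) v≢w)
      ... | s≤s ()

      at~ : f σ v G.~ at p′ (suc q)
      at~ = subst (G._~ at p′ (suc q)) (trans at≡ (trans (cong (at p) (sym lam≡)) at-v))
        (G.~-sym (at-step p′ ≤-refl))

      hom-t : ∀ {u} → u ∉ rest σ → u ~ t → f σ u G.~ at p′ (suc q)
      hom-t u∉ u~t with refl ← only w≁t u∉ u~t = at~

      fresh-t : ∀ {u} → u ∉ rest σ → f σ u ≢ at p′ (suc q)
      fresh-t {u} _ = fresh (s≤s z≤n) ≤-refl u

      open Add σ t∈ (suc q) (at p′ (suc q)) (n≤1+n _) (p′ , refl) t-colour
        fresh-t hom-t sep

      deep′ : ∀ {u} → u ≡ t ⊎ (u ≢ t × u ∉ rest σ) → Deep state u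
      deep′ (inj₂ (_ , u∉)) = deep-old u∉ (deep u∉)
      deep′ (inj₁ refl) {m = m} t~s s∈ o = begin
        ℓ + ℓ           ≡⟨ +-suc (suc q) ℓ ⟨
        suc q + suc ℓ   ≤⟨ +-monoʳ-≤ (suc q) (far (via t~s (λ { refl → v∉ (remove-⊆ s∈) })
                             (remove-⊆ s∈) (out-⊆ remove-⊆ o))) ⟩
        suc q + suc m   ≡⟨ cong (_+ suc m) lam-t ⟨
        lam′ t + suc m  ∎
        where open ≤-Reasoning

    attachPath : lam σ v ≡ ℓ → Out (rest σ) v t (suc q) w → Progress σ
    attachPath lam≡ o with witness σ v∉
    ... | p , at-v with return p (f σ)
    ...   | p′ , at≡ , fresh = record
      { state′ = X.state′
      ; rest-< = X.rest-<
      ; deep   = λ u∉ → deep′ (X.deep u∉)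
      }
      where
      extension : Extension σ v
      -- For `v` at level `ℓ`, depth says that no walk from `v` through `rest σ` to `w` is shorter
      -- than `ℓ`; this is the minimality required here.
      extension = placePath q σ p′ v∉ v≢w lam≡ (trans at≡ (trans (cong (at p) (sym lam≡)) at-v))
        (λ 0<i i<ℓ {u} _ → fresh 0<i i<ℓ u) v~t t∈ o
        λ {_} {m} v~s s∈ o′ → ≤-pred (+-cancelˡ-≤ ℓ ℓ (suc m) (subst (λ i → ℓ + ℓ ≤ i + suc m) lam≡ (deep v∉ v~s s∈ o′)))

      module X = Extension extension

      deep′ : ∀ {u} → (u ∉ rest σ × u ≢ v) ⊎ Deep X.state′ u → Deep X.state′ u
      deep′ (inj₂ d) = d
      deep′ (inj₁ (u∉ , _)) u~s s∈ o′ = subst (λ i → ℓ + ℓ ≤ i + suc _) (sym (X.lam-≡ u∉))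
        (deep u∉ u~s (X.rest-⊆ s∈) (out-⊆ X.rest-⊆ o′))

    attach : Progress σ
    attach with lam σ v ≟ᴺ ℓ
    ... | no lam≢ = attachUp (≤∧≢⇒< (lam≤ σ v∉) lam≢)
    ... | yes lam≡ with out? (rest σ) v t (suc q) w
    ...   | yes o = attachPath lam≡ o
    ...   | no ¬o = attachFold lam≡ ¬o

  -- Since placed vertices other than `w` have no unplaced neighbours, the only walks that could
  -- violate `Separated` are closed ones at `t`, and they would contain a cycle that misses `w`.
  start : (σ : State) → (∀ {v} → v ∉ rest σ → Deep σ v) →
          (∀ {v t} → v ∉ rest σ → v ≢ w → t ∈ rest σ → ¬ v ~ t) → t ∈ rest σ → w ~ t → Progress σ
  start {t} σ deep closed t∈ w~t =
    up σ deep (w∉ σ) t∈ w~t (subst (_< ℓ) (sym (lam-w σ)) (s≤s z≤n)) only sep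
    where
    only : ∀ {u} → u ∉ rest σ → u ~ t → u ≡ w
    only {u} u∉ u~t with u ≟ w
    ... | yes u≡w = u≡w
    ... | no  u≢w = contradiction u~t (closed u∉ u≢w t∈)

    out-closed : b ∉ rest σ → b ≢ w → c ∈ rest σ → ¬ Out (rest σ) p c m b
    out-closed b∉ b≢w c∈ (arrive c~b _)      = closed b∉ b≢w c∈ (~-sym c~b)
    out-closed b∉ b≢w c∈ (via _ _ s∈ o) = out-closed b∉ b≢w s∈ o

    sep : Separated (remove t (rest σ))
    sep a∉ a≢w b∉ b≢w a~s s∈ o with ∉-remove⁻ {t = t} {R = rest σ} a∉ | ∉-remove⁻ {t = t} {R = rest σ} b∉
    ... | inj₂ (_ , a∉R) | _              = closed a∉R a≢w (remove-⊆ s∈) a~s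
    ... | inj₁ refl      | inj₂ (_ , b∉R) = out-closed b∉R b≢w (remove-⊆ s∈) (out-⊆ remove-⊆ o)
    ... | inj₁ refl      | inj₁ refl      =
      closedOut-feedback (w∉ σ) t∈ a~s (remove-⊆ s∈) (out-⊆ remove-⊆ o)

  complete : (σ : State) → (∀ {v t} → v ∉ rest σ → t ∈ rest σ → ¬ v ~ t) → H ⊑ G
  complete σ closed = f σ , (λ {a} {b} → injective σ (placed a) (placed b)) , λ u v → hom σ (placed u) (placed v)
    where
    reach : ∀ {u v} → u ∉ rest σ → Star _~_ u v → v ∉ rest σ
    reach u∉ ε            = u∉
    reach u∉ (u~s ◅ path) = reach (λ s∈ → closed u∉ s∈ u~s) path

    placed : ∀ v → v ∉ rest σ
    placed v = reach (w∉ σ) (connected w v)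

  -- `fuel` exceeds the number of unplaced vertices. Neighbours of `w` come last, because `start`
  -- needs all other placed vertices to be exhausted.
  embed : ∀ fuel (σ : State) → length (rest σ) < fuel → (∀ {v} → v ∉ rest σ → Deep σ v) → H ⊑ G
  embed (suc fuel) σ (s≤s bound) deep
    with any? (λ v → any? λ t → (v ∉? rest σ) ×-dec (¬? (v ≟ w) ×-dec ((t ∈? rest σ) ×-dec (v ~? t))))
  ... | yes (v , t , v∉ , v≢w , t∈ , v~t) = embed fuel state′ (<-≤-trans rest-< bound) deep′
    where open Progress (Attach.attach σ deep v∉ v≢w t∈ v~t) renaming (deep to deep′)
  ... | no closed with any? (λ t → (t ∈? rest σ) ×-dec (w ~? t))
  ...   | yes (t , t∈ , w~t) = embed fuel state′ (<-≤-trans rest-< bound) deep′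
    where open Progress (start σ deep (λ v∉ v≢w t∈ v~t → closed (_ , _ , v∉ , v≢w , t∈ , v~t)) t∈ w~t)
            renaming (deep to deep′)
  ...   | no closed-w = complete σ closed′
    where
    closed′ : ∀ {v t} → v ∉ rest σ → t ∈ rest σ → ¬ v ~ t
    closed′ {v} v∉ t∈ v~t with v ≟ w
    ... | yes refl = closed-w (_ , t∈ , v~t)
    ... | no  v≢w  = closed (_ , _ , v∉ , v≢w , t∈ , v~t)

  embedding : H ⊑ G
  embedding = embed (suc (length (rest σ₀))) σ₀ ≤-refl deep₀
    where
    only-w : v ∉ remove w (allFin h) → v ≡ w
    only-w v∉ with ∉-remove⁻ {t = w} {R = allFin h} v∉
    ... | inj₁ v≡w      = v≡w
    ... | inj₂ (_ , v∉) = contradiction (∈-allFin _) v∉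

    σ₀ : State
    σ₀ = record
      { rest      = remove w (allFin h)
      ; lam       = λ _ → 0
      ; f         = λ _ → root
      ; w∉        = ∉-remove-self {t = w} {R = allFin h}
      ; lam-w     = refl
      ; f-w       = refl
      ; witness   = λ _ → path , at-0 path
      ; lam≤      = λ _ → z≤n
      ; parity    = λ v∉ → cong colour (only-w v∉)
      ; injective = λ a∉ b∉ _ → trans (only-w a∉) (sym (only-w b∉))
      ; hom       = λ a∉ b∉ a~b → contradiction a~b (~-irrefl (trans (only-w a∉) (sym (only-w b∉))))
      ; separated = λ a∉ a≢w _ _ _ _ → contradiction (only-w a∉) a≢w
      }

    deep₀ : v ∉ rest σ₀ → Deep σ₀ v
    deep₀ v∉ with refl ← only-w v∉ = λ w~t t∈ o → closedOut-girth (w∉ σ₀) w~t t∈ o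

-- Pruning a list to a robust sublist or a cover.

module Pruning {P K S : Set} (_≟ᴷ_ : DecidableEquality K) {m : ℕ} (key : Fin m → P → K)
  {Hit : Fin m → S → P → Set} (hit? : ∀ c s p → Dec (Hit c s p)) (candidates : List S) where

  Robust : List P → Set
  Robust ps = ∀ {p} → p ∈ ps → ∀ c {s} → s ∈ candidates →
              ∃ λ p′ → p′ ∈ ps × key c p′ ≡ key c p × ¬ Hit c s p′

  RobustIn : List P → Set
  RobustIn ps = ∃ λ qs → (∀ {p} → p ∈ qs → p ∈ ps) × (∃ λ p → p ∈ qs) × Robust qs

  record Cover (ps : List P) : Set where
    field
      σ        : Fin m → K → S
      σ∈       : ∀ c k → σ c k ∈ candidates
      covering : ∀ {p} → p ∈ ps → ∃ λ c → Hit c (σ c (key c p)) p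

  Violation : List P → P → Fin m → S → Set
  Violation ps p c s = All (λ p′ → key c p′ ≡ key c p → Hit c s p′) ps

  violation? : ∀ ps p c s → Dec (Violation ps p c s)
  violation? ps p c s = All.all? (λ p′ → (key c p′ ≟ᴷ key c p) →-dec hit? c s p′) ps

  noViolation⇒robust : ∀ ps → ¬ Any (λ p → ∃ λ c → Any (Violation ps p c) candidates) ps → Robust ps
  noViolation⇒robust ps ¬viol {p} p∈ c {s} s∈
    with Any.any? (λ p′ → (key c p′ ≟ᴷ key c p) ×-dec ¬? (hit? c s p′)) ps
  ... | yes found = let p′ , p′∈ , key≡ , ¬hit = find found in p′ , p′∈ , key≡ , ¬hit
  ... | no ¬found = contradiction (lose p∈ (c , lose s∈ viol)) ¬viol
    where
    viol : Violation ps p c s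
    viol = All.tabulate λ {p′} p′∈ key≡ →
      decidable-stable (hit? c s p′) λ ¬hit → ¬found (lose p′∈ (key≡ , ¬hit))

  module _ (s₀ : ∃ λ s → s ∈ candidates) where

    -- If `p`, `c` and `s` violate robustness, `s` hits every element that shares the key of `p`
    -- under `c`. All of these are removed and `s` is attached to the key; when nothing is left, the
    -- attached sets form a cover.
    prune : ∀ fuel ps → length ps < fuel → RobustIn ps ⊎ Cover ps
    prune (suc fuel) []         _       = inj₂ record
      { σ = λ _ _ → proj₁ s₀ ; σ∈ = λ _ _ → proj₂ s₀ ; covering = λ () }
    prune (suc fuel) ps@(_ ∷ _) (s≤s b)
      with Any.any? (λ p → any? λ c → Any.any? (violation? ps p c) candidates) ps
    ... | no ¬viol = inj₁ (ps , id , (_ , here refl) , noViolation⇒robust ps ¬viol)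
    ... | yes viol with find viol
    ...   | p , p∈ , c , viol′ with find viol′
    ...     | s , s∈ , hits = Sum.map robust′ cover′ (prune fuel qs (<-≤-trans smaller b))
      where
      key≢? = λ p′ → ¬? (key c p′ ≟ᴷ key c p)
      qs    = filter key≢? ps

      smaller : length qs < length ps
      smaller = filter-notAll key≢? ps (lose p∈ λ key≢ → key≢ refl)

      robust′ : RobustIn qs → RobustIn ps
      robust′ (rs , rs⊆ , rest) = rs , (λ p∈ → proj₁ (∈-filter⁻ key≢? {xs = ps} (rs⊆ p∈))) , rest

      cover′ : Cover qs → Cover ps
      cover′ cov = record { σ = σ′ ; σ∈ = σ′∈ ; covering = covering′ }
        where
        open Cover cov

        isKey? : ∀ c′ k → Dec (c′ ≡ c × k ≡ key c p)
        isKey? c′ k = (c′ ≟ c) ×-dec (k ≟ᴷ key c p)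

        -- Overwriting the value at this key is harmless, because no element of `qs` has it.
        σ′ : Fin m → K → S
        σ′ c′ k = if does (isKey? c′ k) then s else σ c′ k

        σ′∈ : ∀ c′ k → σ′ c′ k ∈ candidates
        σ′∈ c′ k with does (isKey? c′ k)
        ... | true  = s∈
        ... | false = σ∈ c′ k

        covering′ : ∀ {p′} → p′ ∈ ps → ∃ λ c′ → Hit c′ (σ′ c′ (key c′ p′)) p′
        covering′ {p′} p′∈ with key c p′ ≟ᴷ key c p
        ... | yes key≡ = c , subst (λ s′ → Hit c s′ p′) (sym σ′≡s) (All.lookup hits p′∈ key≡)
          where
          σ′≡s : σ′ c (key c p′) ≡ s
          σ′≡s = cong (λ b → if b then s else _) (dec-true (isKey? c (key c p′)) (refl , key≡))
        ... | no key≢ with covering (∈-filter⁺ key≢? p′∈ key≢)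
        ...   | c′ , hit = c′ , subst (λ s′ → Hit c′ s′ p′) (sym σ′≡σ) hit
          where
          σ′≡σ : σ′ c′ (key c′ p′) ≡ σ c′ (key c′ p′)
          σ′≡σ = cong (λ b → if b then s else σ c′ (key c′ p′))
            (dec-false (isKey? c′ (key c′ p′)) λ { (refl , key≡) → key≢ key≡ })

-- Finite sums over lists and counting.

∑ : {A : Set} → List A → (A → ℕ) → ℕ
∑ []       f = 0
∑ (x ∷ xs) f = f x + ∑ xs f

module _ {A : Set} where

  ∑-cong : ∀ xs {f g : A → ℕ} → (∀ {x} → x ∈ xs → f x ≡ g x) → ∑ xs f ≡ ∑ xs g
  ∑-cong []       f≡g = refl
  ∑-cong (x ∷ xs) f≡g = cong₂ _+_ (f≡g (here refl)) (∑-cong xs (f≡g ∘ there))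

  ∑-mono : ∀ xs {f g : A → ℕ} → (∀ {x} → x ∈ xs → f x ≤ g x) → ∑ xs f ≤ ∑ xs g
  ∑-mono []       f≤g = z≤n
  ∑-mono (x ∷ xs) f≤g = +-mono-≤ (f≤g (here refl)) (∑-mono xs (f≤g ∘ there))

  ∑-+ : ∀ xs (f g : A → ℕ) → ∑ xs (λ x → f x + g x) ≡ ∑ xs f + ∑ xs g
  ∑-+ []       f g = refl
  ∑-+ (x ∷ xs) f g = begin
    f x + g x + ∑ xs (λ x → f x + g x)  ≡⟨ cong (f x + g x +_) (∑-+ xs f g) ⟩
    f x + g x + (∑ xs f + ∑ xs g)       ≡⟨ +-assoc (f x) (g x) _ ⟩
    f x + (g x + (∑ xs f + ∑ xs g))     ≡⟨ cong (f x +_) (+-assoc (g x) _ _) ⟨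
    f x + (g x + ∑ xs f + ∑ xs g)       ≡⟨ cong (λ k → f x + (k + ∑ xs g)) (+-comm (g x) _) ⟩
    f x + (∑ xs f + g x + ∑ xs g)       ≡⟨ cong (f x +_) (+-assoc (∑ xs f) _ _) ⟩
    f x + (∑ xs f + (g x + ∑ xs g))     ≡⟨ +-assoc (f x) _ _ ⟨
    f x + ∑ xs f + (g x + ∑ xs g)       ∎
    where open ≡-Reasoning

  ∑-*ˡ : ∀ xs c (f : A → ℕ) → ∑ xs (λ x → c * f x) ≡ c * ∑ xs f
  ∑-*ˡ []       c f = sym (*-zeroʳ c)
  ∑-*ˡ (x ∷ xs) c f = trans (cong (c * f x +_) (∑-*ˡ xs c f)) (sym (*-distribˡ-+ c (f x) _))

  ∑-*ʳ : ∀ xs (f : A → ℕ) c → ∑ xs (λ x → f x * c) ≡ ∑ xs f * c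
  ∑-*ʳ xs f c = trans (∑-cong xs λ {x} _ → *-comm (f x) c) (trans (∑-*ˡ xs c f) (*-comm c _))

  ∑-const : ∀ (xs : List A) c → ∑ xs (λ _ → c) ≡ length xs * c
  ∑-const []       c = refl
  ∑-const (x ∷ xs) c = cong (c +_) (∑-const xs c)

  ∑-++ : ∀ xs ys (f : A → ℕ) → ∑ (xs ++ ys) f ≡ ∑ xs f + ∑ ys f
  ∑-++ []       ys f = refl
  ∑-++ (x ∷ xs) ys f = trans (cong (f x +_) (∑-++ xs ys f)) (sym (+-assoc (f x) _ _))

  ∈⇒≤∑ : ∀ {xs x} (f : A → ℕ) → x ∈ xs → f x ≤ ∑ xs f
  ∈⇒≤∑ f (here refl) = m≤m+n _ _
  ∈⇒≤∑ f (there x∈)  = ≤-trans (∈⇒≤∑ f x∈) (m≤n+m _ _)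

∑-map : ∀ {A B : Set} (g : A → B) xs (f : B → ℕ) → ∑ (map g xs) f ≡ ∑ xs (f ∘ g)
∑-map g []       f = refl
∑-map g (x ∷ xs) f = cong (f (g x) +_) (∑-map g xs f)

∑-swap : ∀ {A B : Set} xs ys (f : A → B → ℕ) → ∑ xs (λ x → ∑ ys (f x)) ≡ ∑ ys (λ y → ∑ xs (λ x → f x y))
∑-swap []       ys f = sym (trans (∑-const ys 0) (*-zeroʳ (length ys)))
∑-swap (x ∷ xs) ys f = trans (cong (∑ ys (f x) +_) (∑-swap xs ys f)) (sym (∑-+ ys (f x) _))

∑-cartesianProductWith : ∀ {A B C : Set} (g : A → B → C) xs ys (f : C → ℕ) →
  ∑ (cartesianProductWith g xs ys) f ≡ ∑ xs (λ x → ∑ ys (λ y → f (g x y)))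
∑-cartesianProductWith g []       ys f = refl
∑-cartesianProductWith g (x ∷ xs) ys f = trans (∑-++ (map (g x) ys) _ f)
  (cong₂ _+_ (∑-map (g x) ys f) (∑-cartesianProductWith g xs ys f))

length≡∑ : ∀ {A : Set} (xs : List A) → length xs ≡ ∑ xs (λ _ → 1)
length≡∑ xs = sym (trans (∑-const xs 1) (*-identityʳ _))

length-cartesianProductWith : ∀ {A B C : Set} (g : A → B → C) xs ys →
  length (cartesianProductWith g xs ys) ≡ length xs * length ys
length-cartesianProductWith g xs ys = begin
  length (cartesianProductWith g xs ys)       ≡⟨ length≡∑ (cartesianProductWith g xs ys) ⟩
  ∑ (cartesianProductWith g xs ys) (λ _ → 1)  ≡⟨ ∑-cartesianProductWith g xs ys _ ⟩
  ∑ xs (λ _ → ∑ ys (λ _ → 1))                 ≡⟨ ∑-cong xs (λ _ → sym (length≡∑ ys)) ⟩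
  ∑ xs (λ _ → length ys)                      ≡⟨ ∑-const xs _ ⟩
  length xs * length ys                       ∎
  where open ≡-Reasoning

length-concatMap≤ : ∀ {A B : Set} (f : A → List B) xs {c} → (∀ {x} → x ∈ xs → length (f x) ≤ c) →
                    length (concatMap f xs) ≤ length xs * c
length-concatMap≤ f []       f≤ = z≤n
length-concatMap≤ f (x ∷ xs) f≤ = ≤-trans (≤-reflexive (length-++ (f x)))
  (+-mono-≤ (f≤ (here refl)) (length-concatMap≤ f xs (f≤ ∘ there)))

unique-⊆-length : ∀ {A : Set} {xs ys : List A} → Unique xs → (∀ {x} → x ∈ xs → x ∈ ys) → length xs ≤ length ys
unique-⊆-length {xs = []} _ _ = z≤n
unique-⊆-length {xs = x ∷ xs} {ys} (x≢ ∷ u) xs⊆ with ∈-∃++ (xs⊆ (here refl))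
... | as , bs , refl = begin
  suc (length xs)              ≤⟨ s≤s (unique-⊆-length u xs⊆′) ⟩
  suc (length (as ++ bs))      ≡⟨ cong suc (length-++ as) ⟩
  suc (length as + length bs)  ≡⟨ +-suc (length as) (length bs) ⟨
  length as + suc (length bs)  ≡⟨ length-++ as ⟨
  length (as ++ x ∷ bs)        ∎
  where
  open ≤-Reasoning

  xs⊆′ : ∀ {y} → y ∈ xs → y ∈ as ++ bs
  xs⊆′ y∈ with ∈-++⁻ as (xs⊆ (there y∈))
  ... | inj₁ y∈as           = ∈-++⁺ˡ y∈as
  ... | inj₂ (here refl)    = contradiction refl (All.lookup x≢ y∈)
  ... | inj₂ (there y∈bs)   = ∈-++⁺ʳ as y∈bs

𝟙 : Bool → ℕ
𝟙 true  = 1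
𝟙 false = 0

𝟙≤1 : ∀ b → 𝟙 b ≤ 1
𝟙≤1 true  = ≤-refl
𝟙≤1 false = z≤n

length-filter≡∑ : ∀ {A : Set} {P : A → Set} (P? : ∀ x → Dec (P x)) xs →
                  length (filter P? xs) ≡ ∑ xs (λ x → 𝟙 (does (P? x)))
length-filter≡∑ P? []       = refl
length-filter≡∑ P? (x ∷ xs) with does (P? x)
... | true  = cong suc (length-filter≡∑ P? xs)
... | false = length-filter≡∑ P? xs

-- Vertex sequences of fixed length.

module Sequences (n : ℕ) where

  vertices : List (Fin n)
  vertices = allFin n

  sequences : ℕ → List (List (Fin n))
  sequences zero    = [] ∷ []
  sequences (suc m) = cartesianProductWith _∷_ vertices (sequences m)

  ∈-sequences⁺ : ∀ xs → xs ∈ sequences (length xs)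
  ∈-sequences⁺ []       = here refl
  ∈-sequences⁺ (x ∷ xs) = ∈-cartesianProductWith⁺ _∷_ (∈-allFin x) (∈-sequences⁺ xs)

  ∈-sequences⁻ : ∀ m {xs} → xs ∈ sequences m → length xs ≡ m
  ∈-sequences⁻ zero    (here refl) = refl
  ∈-sequences⁻ (suc m) xs∈ with ∈-cartesianProductWith⁻ _∷_ vertices (sequences m) xs∈
  ... | _ , _ , _ , r∈ , refl = cong suc (∈-sequences⁻ m r∈)

  sequences-unique : ∀ m → Unique (sequences m)
  sequences-unique zero    = [] ∷ []
  sequences-unique (suc m) =
    cartesianProductWith⁺ _∷_ (λ { refl → refl , refl }) (allFin⁺ n) (sequences-unique m)

  ∑-cons : ∀ m f → ∑ (sequences (suc m)) f ≡ ∑ vertices (λ x → ∑ (sequences m) (λ r → f (x ∷ r)))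
  ∑-cons m f = ∑-cartesianProductWith _∷_ vertices (sequences m) f

  ∑-snoc : ∀ m f → ∑ (sequences (suc m)) f ≡ ∑ (sequences m) (λ p → ∑ vertices (λ z → f (p ++ z ∷ [])))
  ∑-snoc zero f = begin
    ∑ (sequences 1) f                     ≡⟨ ∑-cons 0 f ⟩
    ∑ vertices (λ x → f (x ∷ []) + 0)     ≡⟨ ∑-cong vertices (λ _ → +-identityʳ _) ⟩
    ∑ vertices (λ x → f (x ∷ []))         ≡⟨ +-identityʳ _ ⟨
    ∑ vertices (λ x → f (x ∷ [])) + 0     ∎
    where open ≡-Reasoning
  ∑-snoc (suc m) f = begin
    ∑ (sequences (2 + m)) f
      ≡⟨ ∑-cons (suc m) f ⟩
    ∑ vertices (λ x → ∑ (sequences (suc m)) (λ r → f (x ∷ r)))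
      ≡⟨ ∑-cong vertices (λ {x} _ → ∑-snoc m (λ r → f (x ∷ r))) ⟩
    ∑ vertices (λ x → ∑ (sequences m) (λ p → ∑ vertices (λ z → f (x ∷ p ++ z ∷ []))))
      ≡⟨ ∑-cons m (λ p → ∑ vertices (λ z → f (p ++ z ∷ []))) ⟨
    ∑ (sequences (suc m)) (λ p → ∑ vertices (λ z → f (p ++ z ∷ []))) ∎
    where open ≡-Reasoning

-- d is the junk value beyond the end of the list.
at : {A : Set} → A → List A → ℕ → A
at d []       _       = d
at d (x ∷ _)  zero    = x
at d (_ ∷ xs) (suc i) = at d xs i

-- Walks weighted by the stationary measure.

module Weights {n : ℕ} (G : Graph n) (d : Fin n) where
  open Graph G
  open Sequences n
  open DecMembership (_≟_ {n}) using (_∈?_)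

  adj : Fin n → Fin n → ℕ
  adj u v = 𝟙 (does (u ~? v))

  deg : Fin n → ℕ
  deg u = ∑ vertices (adj u)

  volume : ℕ
  volume = ∑ vertices deg

  adj-sym : ∀ u v → adj u v ≡ adj v u
  adj-sym u v with u ~? v | v ~? u
  ... | yes _   | yes _   = refl
  ... | no  _   | no  _   = refl
  ... | yes u~v | no  v≁u = contradiction (~-sym u~v) v≁u
  ... | no  u≁v | yes v~u = contradiction (~-sym v~u) u≁v

  adj≤1 : ∀ u v → adj u v ≤ 1
  adj≤1 u v = 𝟙≤1 (does (u ~? v))

  deg≤n : ∀ v → deg v ≤ n
  deg≤n v = begin
    ∑ vertices (adj v)      ≤⟨ ∑-mono vertices (λ {u} _ → adj≤1 v u) ⟩
    ∑ vertices (λ _ → 1)    ≡⟨ length≡∑ vertices ⟨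
    length vertices         ≡⟨ length-tabulate (λ i → i) ⟩
    n                       ∎
    where open ≤-Reasoning

  -- A common denominator: a nonzero degree is at most `n` and hence divides `n !`.
  P : ℕ
  P = n !

  cofactor : ∀ k → k ≤ n → ∃ λ q → k ≡ 0 ⊎ q * k ≡ P
  cofactor zero    _   = 0 , inj₁ refl
  cofactor (suc k) k≤n with ∣-trans (m∣m*n (k !)) (m≤n⇒m!∣n! k≤n)
  ... | divides q eq = q , inj₂ (sym eq)

  -- P / deg v, so that all weights are natural numbers.
  q : Fin n → ℕ
  q v = proj₁ (cofactor (deg v) (deg≤n v))

  q*deg : ∀ v → deg v ≡ 0 ⊎ q v * deg v ≡ P
  q*deg v = proj₂ (cofactor (deg v) (deg≤n v))

  q*deg≤P : ∀ v → q v * deg v ≤ P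
  q*deg≤P v with q*deg v
  ... | inj₁ deg≡0 = subst (_≤ P) (sym (trans (cong (q v *_) deg≡0) (*-zeroʳ (q v)))) z≤n
  ... | inj₂ eq    = ≤-reflexive eq

  -- A vertex of degree 0, the one case without an exact cofactor, is adjacent to nothing, so both
  -- sides vanish there.
  adj-q-deg : ∀ u v → adj u v * (q v * deg v) ≡ adj u v * P
  adj-q-deg u v with q*deg v
  ... | inj₂ eq    = cong (adj u v *_) eq
  ... | inj₁ deg≡0 = trans (cong (_* (q v * deg v)) adj≡0) (sym (cong (_* P) adj≡0))
    where
    adj≡0 : adj u v ≡ 0
    adj≡0 = n≤0⇒n≡0 (begin
      adj u v  ≡⟨ adj-sym u v ⟩
      adj v u  ≤⟨ ∈⇒≤∑ (adj v) (∈-allFin u) ⟩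
      deg v    ≡⟨ deg≡0 ⟩
      0        ∎)
      where open ≤-Reasoning

  -- The stationary measure of the simple random walk, scaled: for m ≥ 1, a walk x₀ … x_m has
  -- weight P ^ m / (deg x₁ ⋯ deg x_{m-1}), and all other sequences have weight 0.
  weight : List (Fin n) → ℕ
  weight []          = 0
  weight (x ∷ [])    = deg x
  weight (x ∷ y ∷ r) = adj x y * (q y * weight (y ∷ r))

  -- At each vertex `y` after `x` the factor `q y` cancels against `deg y`, leaving one factor `P`.
  weight-from : ∀ m x → ∑ (sequences m) (λ r → weight (x ∷ r)) ≡ deg x * P ^ m
  weight-from zero    x = trans (+-identityʳ _) (sym (*-identityʳ _))
  weight-from (suc m) x = begin
    ∑ (sequences (suc m)) (λ r → weight (x ∷ r))
      ≡⟨ ∑-cons m _ ⟩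
    ∑ vertices (λ y → ∑ (sequences m) (λ r → adj x y * (q y * weight (y ∷ r))))
      ≡⟨ ∑-cong vertices (λ {y} _ → trans (∑-*ˡ (sequences m) (adj x y) _)
           (cong (adj x y *_) (trans (∑-*ˡ (sequences m) (q y) _) (cong (q y *_) (weight-from m y))))) ⟩
    ∑ vertices (λ y → adj x y * (q y * (deg y * P ^ m)))
      ≡⟨ ∑-cong vertices (λ {y} _ → step y) ⟩
    ∑ vertices (λ y → adj x y * (P * P ^ m))
      ≡⟨ ∑-*ʳ vertices (adj x) _ ⟩
    deg x * P ^ suc m ∎
    where
    open ≡-Reasoning
    step : ∀ y → adj x y * (q y * (deg y * P ^ m)) ≡ adj x y * (P * P ^ m)
    step y = begin
      adj x y * (q y * (deg y * P ^ m))  ≡⟨ cong (adj x y *_) (*-assoc (q y) _ _) ⟨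
      adj x y * (q y * deg y * P ^ m)    ≡⟨ *-assoc (adj x y) _ _ ⟨
      adj x y * (q y * deg y) * P ^ m    ≡⟨ cong (_* P ^ m) (adj-q-deg x y) ⟩
      adj x y * P * P ^ m                ≡⟨ *-assoc (adj x y) _ _ ⟩
      adj x y * (P * P ^ m)              ∎

  total : ℕ → ℕ
  total m = volume * P ^ m

  weight-total : ∀ m → ∑ (sequences (suc m)) weight ≡ total m
  weight-total m = trans (∑-cons m weight)
    (trans (∑-cong vertices (λ {x} _ → weight-from m x)) (∑-*ʳ vertices deg (P ^ m)))

  -- Stationarity: by symmetry of `adj`, the `deg y` choices of a new first vertex each contribute
  -- the factor `q y`.
  weight-front : ∀ y r → ∑ vertices (λ x → weight (x ∷ y ∷ r)) ≤ P * weight (y ∷ r)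
  weight-front y r = begin
    ∑ vertices (λ x → adj x y * (q y * weight (y ∷ r)))
      ≡⟨ ∑-*ʳ vertices (λ x → adj x y) _ ⟩
    ∑ vertices (λ x → adj x y) * (q y * weight (y ∷ r))
      ≡⟨ cong (_* (q y * weight (y ∷ r))) (∑-cong vertices λ {x} _ → adj-sym x y) ⟩
    deg y * (q y * weight (y ∷ r))
      ≡⟨ *-assoc (deg y) _ _ ⟨
    deg y * q y * weight (y ∷ r)
      ≡⟨ cong (_* weight (y ∷ r)) (*-comm (deg y) (q y)) ⟩
    q y * deg y * weight (y ∷ r)
      ≤⟨ *-monoˡ-≤ (weight (y ∷ r)) (q*deg≤P y) ⟩
    P * weight (y ∷ r) ∎
    where open ≤-Reasoning

  weight-back : ∀ x r → ∑ vertices (λ z → weight (x ∷ r ++ z ∷ [])) ≡ P * weight (x ∷ r)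
  weight-back x [] = begin
    ∑ vertices (λ z → adj x z * (q z * deg z))  ≡⟨ ∑-cong vertices (λ {z} _ → adj-q-deg x z) ⟩
    ∑ vertices (λ z → adj x z * P)              ≡⟨ ∑-*ʳ vertices (adj x) P ⟩
    deg x * P                                   ≡⟨ *-comm (deg x) P ⟩
    P * deg x                                   ∎
    where open ≡-Reasoning
  weight-back x (y ∷ r) = begin
    ∑ vertices (λ z → adj x y * (q y * weight (y ∷ r ++ z ∷ [])))
      ≡⟨ trans (∑-*ˡ vertices (adj x y) _) (cong (adj x y *_) (∑-*ˡ vertices (q y) _)) ⟩
    adj x y * (q y * ∑ vertices (λ z → weight (y ∷ r ++ z ∷ [])))
      ≡⟨ cong (λ k → adj x y * (q y * k)) (weight-back y r) ⟩
    adj x y * (q y * (P * weight (y ∷ r)))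
      ≡⟨ cong (adj x y *_) (x*[p*w] (q y) P (weight (y ∷ r))) ⟩
    adj x y * (P * (q y * weight (y ∷ r)))
      ≡⟨ x*[p*w] (adj x y) P _ ⟩
    P * weight (x ∷ y ∷ r) ∎
    where
    open ≡-Reasoning
    x*[p*w] : ∀ a b c → a * (b * c) ≡ b * (a * c)
    x*[p*w] a b c = trans (sym (*-assoc a b c)) (trans (cong (_* c) (*-comm a b)) (*-assoc b a c))

  -- `m` counts edges, hence `suc m` vertices; relative to `total m` this is the probability of `B`.
  mass : ℕ → (List (Fin n) → Bool) → ℕ
  mass m B = ∑ (sequences (suc m)) (λ p → weight p * 𝟙 (B p))

  mass-drop : ∀ m B → mass (suc m) (B ∘ drop 1) ≤ P * mass m B
  mass-drop m B = begin
    mass (suc m) (B ∘ drop 1)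
      ≡⟨ ∑-cons (suc m) _ ⟩
    ∑ vertices (λ x → ∑ (sequences (suc m)) (λ r → weight (x ∷ r) * 𝟙 (B r)))
      ≡⟨ ∑-swap vertices (sequences (suc m)) _ ⟩
    ∑ (sequences (suc m)) (λ r → ∑ vertices (λ x → weight (x ∷ r) * 𝟙 (B r)))
      ≡⟨ ∑-cong (sequences (suc m)) (λ {r} _ → ∑-*ʳ vertices (λ x → weight (x ∷ r)) _) ⟩
    ∑ (sequences (suc m)) (λ r → ∑ vertices (λ x → weight (x ∷ r)) * 𝟙 (B r))
      ≤⟨ ∑-mono (sequences (suc m)) (λ {r} r∈ → *-monoˡ-≤ (𝟙 (B r)) (front r (∈-sequences⁻ (suc m) r∈))) ⟩
    ∑ (sequences (suc m)) (λ r → P * weight r * 𝟙 (B r))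
      ≡⟨ ∑-cong (sequences (suc m)) (λ {r} _ → *-assoc P (weight r) _) ⟩
    ∑ (sequences (suc m)) (λ r → P * (weight r * 𝟙 (B r)))
      ≡⟨ ∑-*ˡ (sequences (suc m)) P _ ⟩
    P * mass m B ∎
    where
    open ≤-Reasoning
    front : ∀ r → length r ≡ suc m → ∑ vertices (λ x → weight (x ∷ r)) ≤ P * weight r
    front (y ∷ r) _ = weight-front y r

  mass-take : ∀ m B → mass (suc m) (B ∘ take (suc m)) ≡ P * mass m B
  mass-take m B = begin
    mass (suc m) (B ∘ take (suc m))
      ≡⟨ ∑-snoc (suc m) _ ⟩
    ∑ (sequences (suc m)) (λ p → ∑ vertices (λ z → weight (p ++ z ∷ []) * 𝟙 (B (take (suc m) (p ++ z ∷ [])))))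
      ≡⟨ ∑-cong (sequences (suc m)) (λ {p} p∈ → back p (∈-sequences⁻ (suc m) p∈)) ⟩
    ∑ (sequences (suc m)) (λ p → P * (weight p * 𝟙 (B p)))
      ≡⟨ ∑-*ˡ (sequences (suc m)) P _ ⟩
    P * mass m B ∎
    where
    open ≡-Reasoning
    back : ∀ p → length p ≡ suc m →
      ∑ vertices (λ z → weight (p ++ z ∷ []) * 𝟙 (B (take (suc m) (p ++ z ∷ [])))) ≡ P * (weight p * 𝟙 (B p))
    back p@(x ∷ r) len = begin
      ∑ vertices (λ z → weight (p ++ z ∷ []) * 𝟙 (B (take (suc m) (p ++ z ∷ []))))
        ≡⟨ ∑-cong vertices (λ {z} _ → cong (λ s → weight (p ++ z ∷ []) * 𝟙 (B s)) (take-++ z)) ⟩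
      ∑ vertices (λ z → weight (p ++ z ∷ []) * 𝟙 (B p))
        ≡⟨ ∑-*ʳ vertices (λ z → weight (p ++ z ∷ [])) _ ⟩
      ∑ vertices (λ z → weight (p ++ z ∷ [])) * 𝟙 (B p)
        ≡⟨ cong (_* 𝟙 (B p)) (weight-back x r) ⟩
      P * weight p * 𝟙 (B p)
        ≡⟨ *-assoc P _ _ ⟩
      P * (weight p * 𝟙 (B p)) ∎
      where
      take-++ : ∀ z → take (suc m) (p ++ z ∷ []) ≡ p
      take-++ z = subst (λ k → take k (p ++ z ∷ []) ≡ p) len (take-length p)
        where
        take-length : ∀ (xs : List (Fin n)) {ys} → take (length xs) (xs ++ ys) ≡ xs
        take-length []       = refl
        take-length (x ∷ xs) = cong (x ∷_) (take-length xs)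

  module _ (L : ℕ) where

    -- Degree at least 1 / `L` of the average degree `volume` / `n`.
    high : Fin n → Bool
    high v = volume ≤ᵇ L * n * deg v

    hits : ℕ → (Fin n → List (Fin n)) → List (Fin n) → Bool
    hits i S p = high (at d p i) ∧ does (at d p (suc i) ∈? S (at d p i))

    ∑∈≤length : ∀ (S : List (Fin n)) → ∑ vertices (λ y → 𝟙 (does (y ∈? S))) ≤ length S
    ∑∈≤length S = begin
      ∑ vertices (λ y → 𝟙 (does (y ∈? S)))     ≡⟨ length-filter≡∑ (_∈? S) vertices ⟨
      length (filter (_∈? S) vertices)         ≤⟨ unique-⊆-length (filter⁺ (_∈? S) (allFin⁺ n))
                                                    (λ y∈ → proj₂ (∈-filter⁻ (_∈? S) {xs = vertices} y∈)) ⟩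
      length S                                 ∎
      where open ≤-Reasoning

    -- A high vertex has at least `volume / (L * n)` equally likely successors, of which at most `s`
    -- lie in the set; for larger `i` one first conditions on the next vertex.
    hits-from : ∀ {s} (S : Fin n → List (Fin n)) → (∀ v → length (S v) ≤ s) → ∀ m i x → i < m →
      volume * ∑ (sequences m) (λ r → weight (x ∷ r) * 𝟙 (hits i S (x ∷ r))) ≤ s * (L * n) * (deg x * P ^ m)
    hits-from {s} S S≤ (suc m) zero x _ with high x in high-x
    ... | false = begin
      volume * ∑ (sequences (suc m)) (λ r → weight (x ∷ r) * 0)
        ≡⟨ cong (volume *_) (trans (∑-*ʳ (sequences (suc m)) (λ r → weight (x ∷ r)) 0)
             (*-zeroʳ (∑ (sequences (suc m)) (λ r → weight (x ∷ r))))) ⟩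
      volume * 0                                                 ≡⟨ *-zeroʳ volume ⟩
      0                                                          ≤⟨ z≤n ⟩
      s * (L * n) * (deg x * P ^ suc m)                          ∎
      where open ≤-Reasoning
    ... | true = begin
      volume * ∑ (sequences (suc m)) (λ r → weight (x ∷ r) * 𝟙 (does (at d r 0 ∈? S x)))
        ≡⟨ cong (volume *_) (∑-cons m _) ⟩
      volume * ∑ vertices (λ y → ∑ (sequences m) (λ r → weight (x ∷ y ∷ r) * 𝟙 (does (y ∈? S x))))
        ≡⟨ cong (volume *_) (∑-cong vertices (λ {y} _ → ∑-*ʳ (sequences m) _ _)) ⟩
      volume * ∑ vertices (λ y → ∑ (sequences m) (λ r → weight (x ∷ y ∷ r)) * 𝟙 (does (y ∈? S x)))
        ≤⟨ *-monoʳ-≤ volume (∑-mono vertices (λ {y} _ → *-monoˡ-≤ _ (through y))) ⟩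
      volume * ∑ vertices (λ y → P ^ suc m * 𝟙 (does (y ∈? S x)))
        ≡⟨ cong (volume *_) (∑-*ˡ vertices (P ^ suc m) _) ⟩
      volume * (P ^ suc m * ∑ vertices (λ y → 𝟙 (does (y ∈? S x))))
        ≤⟨ *-monoʳ-≤ volume (*-monoʳ-≤ (P ^ suc m) (≤-trans (∑∈≤length (S x)) (S≤ x))) ⟩
      volume * (P ^ suc m * s)
        ≤⟨ *-monoˡ-≤ (P ^ suc m * s) (≤ᵇ⇒≤ volume (L * n * deg x) (subst T (sym high-x) tt)) ⟩
      L * n * deg x * (P ^ suc m * s)
        ≡⟨ solve 4 (λ a b c e → a :* b :* (c :* e) := e :* a :* (b :* c)) refl (L * n) (deg x) (P ^ suc m) s ⟩
      s * (L * n) * (deg x * P ^ suc m) ∎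
      where
      open ≤-Reasoning
      through : ∀ y → ∑ (sequences m) (λ r → weight (x ∷ y ∷ r)) ≤ P ^ suc m
      through y = begin
        ∑ (sequences m) (λ r → adj x y * (q y * weight (y ∷ r)))
          ≡⟨ trans (∑-*ˡ (sequences m) (adj x y) _) (cong (adj x y *_) (∑-*ˡ (sequences m) (q y) _)) ⟩
        adj x y * (q y * ∑ (sequences m) (λ r → weight (y ∷ r)))
          ≡⟨ cong (λ k → adj x y * (q y * k)) (weight-from m y) ⟩
        adj x y * (q y * (deg y * P ^ m))
          ≡⟨ cong (adj x y *_) (*-assoc (q y) _ _) ⟨
        adj x y * (q y * deg y * P ^ m)
          ≤⟨ *-mono-≤ (adj≤1 x y) (*-monoˡ-≤ (P ^ m) (q*deg≤P y)) ⟩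
        1 * (P * P ^ m)
          ≡⟨ *-identityˡ _ ⟩
        P ^ suc m ∎
    hits-from {s} S S≤ (suc m) (suc i) x (s≤s i<m) = begin
      volume * ∑ (sequences (suc m)) (λ r → weight (x ∷ r) * 𝟙 (hits i S r))
        ≡⟨ cong (volume *_) (∑-cons m _) ⟩
      volume * ∑ vertices (λ y → ∑ (sequences m) (λ r → adj x y * (q y * weight (y ∷ r)) * 𝟙 (hits i S (y ∷ r))))
        ≡⟨ cong (volume *_) (∑-cong vertices (λ {y} _ → pull y)) ⟩
      volume * ∑ vertices (λ y → adj x y * (q y * Z y))
        ≡⟨ ∑-*ˡ vertices volume _ ⟨
      ∑ vertices (λ y → volume * (adj x y * (q y * Z y)))
        ≤⟨ ∑-mono vertices (λ {y} _ → bound y) ⟩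
      ∑ vertices (λ y → adj x y * (s * (L * n) * P ^ suc m))
        ≡⟨ ∑-*ʳ vertices (adj x) _ ⟩
      deg x * (s * (L * n) * P ^ suc m)
        ≡⟨ solve 3 (λ a b c → a :* (b :* c) := b :* (a :* c)) refl (deg x) (s * (L * n)) (P ^ suc m) ⟩
      s * (L * n) * (deg x * P ^ suc m) ∎
      where
      open ≤-Reasoning
      Z : Fin n → ℕ
      Z y = ∑ (sequences m) (λ r → weight (y ∷ r) * 𝟙 (hits i S (y ∷ r)))

      pull : ∀ y → ∑ (sequences m) (λ r → adj x y * (q y * weight (y ∷ r)) * 𝟙 (hits i S (y ∷ r))) ≡
                   adj x y * (q y * Z y)
      pull y = trans (∑-cong (sequences m) λ {r} _ →
          trans (*-assoc (adj x y) _ (𝟙 (hits i S (y ∷ r)))) (cong (adj x y *_) (*-assoc (q y) _ _)))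
        (trans (∑-*ˡ (sequences m) (adj x y) _) (cong (adj x y *_) (∑-*ˡ (sequences m) (q y) _)))

      bound : ∀ y → volume * (adj x y * (q y * Z y)) ≤ adj x y * (s * (L * n) * P ^ suc m)
      bound y = begin
        volume * (adj x y * (q y * Z y))
          ≡⟨ solve 4 (λ a b c e → a :* (b :* (c :* e)) := b :* c :* (a :* e)) refl volume (adj x y) (q y) (Z y) ⟩
        adj x y * q y * (volume * Z y)
          ≤⟨ *-monoʳ-≤ (adj x y * q y) (hits-from S S≤ m i y i<m) ⟩
        adj x y * q y * (s * (L * n) * (deg y * P ^ m))
          ≡⟨ solve 5 (λ a b c e f → a :* b :* (c :* (e :* f)) := a :* (b :* e :* (c :* f)))
               refl (adj x y) (q y) (s * (L * n)) (deg y) (P ^ m) ⟩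
        adj x y * (q y * deg y * (s * (L * n) * P ^ m))
          ≤⟨ *-monoʳ-≤ (adj x y) (*-monoˡ-≤ (s * (L * n) * P ^ m) (q*deg≤P y)) ⟩
        adj x y * (P * (s * (L * n) * P ^ m))
          ≡⟨ cong (adj x y *_) (solve 3 (λ a b c → a :* (b :* c) := b :* (a :* c)) refl P (s * (L * n)) (P ^ m)) ⟩
        adj x y * (s * (L * n) * P ^ suc m) ∎

    -- The set may depend on the first vertex as well, because `hits-from` holds for each fixed
    -- start.
    mass-hits : ∀ {s} (S : Fin n → Fin n → List (Fin n)) → (∀ x v → length (S x v) ≤ s) → ∀ {m i} → i < m →
      volume * mass m (λ p → hits i (S (at d p 0)) p) ≤ s * (L * n) * total m
    mass-hits {s} S S≤ {m} {i} i<m = begin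
      volume * mass m (λ p → hits i (S (at d p 0)) p)
        ≡⟨ cong (volume *_) (∑-cons m _) ⟩
      volume * ∑ vertices (λ x → ∑ (sequences m) (λ r → weight (x ∷ r) * 𝟙 (hits i (S x) (x ∷ r))))
        ≡⟨ ∑-*ˡ vertices volume _ ⟨
      ∑ vertices (λ x → volume * ∑ (sequences m) (λ r → weight (x ∷ r) * 𝟙 (hits i (S x) (x ∷ r))))
        ≤⟨ ∑-mono vertices (λ {x} _ → hits-from (S x) (S≤ x) m i x i<m) ⟩
      ∑ vertices (λ x → s * (L * n) * (deg x * P ^ m))
        ≡⟨ trans (∑-*ˡ vertices (s * (L * n)) _) (cong (s * (L * n) *_) (∑-*ʳ vertices deg _)) ⟩
      s * (L * n) * total m ∎
      where open ≤-Reasoning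

    -- Each of at most `n` low vertices contributes at most `volume / (L * n)`.
    mass-low : ∀ .{{_ : NonZero n}} → L * mass 0 (λ p → not (high (at d p 0))) ≤ total 0
    mass-low = *-cancelˡ-≤ n (begin
      n * (L * mass 0 (λ p → not (high (at d p 0))))
        ≡⟨ cong (λ k → n * (L * k)) (trans (∑-cons 0 _) (∑-cong vertices λ _ → +-identityʳ _)) ⟩
      n * (L * ∑ vertices (λ x → deg x * 𝟙 (not (high x))))
        ≡⟨ solve 3 (λ a b c → a :* (b :* c) := b :* a :* c) refl n L _ ⟩
      L * n * ∑ vertices (λ x → deg x * 𝟙 (not (high x)))
        ≡⟨ ∑-*ˡ vertices (L * n) _ ⟨
      ∑ vertices (λ x → L * n * (deg x * 𝟙 (not (high x))))
        ≤⟨ ∑-mono vertices (λ {x} _ → low x) ⟩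
      ∑ vertices (λ _ → volume)
        ≡⟨ ∑-const vertices volume ⟩
      length vertices * volume
        ≡⟨ cong₂ _*_ (length-tabulate {n = n} (λ i → i)) (sym (*-identityʳ volume)) ⟩
      n * total 0 ∎)
      where
      open ≤-Reasoning
      low : ∀ x → L * n * (deg x * 𝟙 (not (high x))) ≤ volume
      low x with high x in high-x
      ... | true  = ≤-trans (≤-reflexive (trans (cong (L * n *_) (*-zeroʳ (deg x))) (*-zeroʳ (L * n)))) z≤n
      ... | false = subst (λ k → L * n * k ≤ volume) (sym (*-identityʳ (deg x)))
        (≰⇒≥ λ le → subst T high-x (≤⇒≤ᵇ le))

    -- A high vertex `v` has `q v * volume` at most `L * n * P`; the exponent `length r` is the
    -- number of interior vertices.
    weight≤ : ∀ x y r → (∀ {i} → 0 < i → i < suc (length r) → T (high (at d (x ∷ y ∷ r) i))) →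
      weight (x ∷ y ∷ r) * volume ^ length r ≤ (L * n * P) ^ length r * P
    weight≤ x y [] _ = begin
      adj x y * (q y * deg y) * 1  ≡⟨ *-identityʳ _ ⟩
      adj x y * (q y * deg y)      ≤⟨ *-mono-≤ (adj≤1 x y) (q*deg≤P y) ⟩
      1 * P                        ∎
      where open ≤-Reasoning
    weight≤ x y (z ∷ r) highs = begin
      adj x y * (q y * w) * (volume * volume ^ k)
        ≤⟨ *-monoˡ-≤ (volume * volume ^ k) (*-monoˡ-≤ (q y * w) (adj≤1 x y)) ⟩
      1 * (q y * w) * (volume * volume ^ k)
        ≡⟨ solve 4 (λ a b c e → con 1 :* (a :* b) :* (c :* e) := a :* c :* (b :* e)) refl (q y) w volume (volume ^ k) ⟩
      q y * volume * (w * volume ^ k)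
        ≤⟨ *-mono-≤ q*volume≤ (weight≤ y z r λ { {suc i} 0<i i<k → highs (s≤s z≤n) (s≤s i<k) }) ⟩
      L * n * P * ((L * n * P) ^ k * P)
        ≡⟨ *-assoc (L * n * P) _ _ ⟨
      (L * n * P) ^ suc k * P ∎
      where
      open ≤-Reasoning
      k = length r
      w = weight (y ∷ z ∷ r)

      q*volume≤ : q y * volume ≤ L * n * P
      q*volume≤ = begin
        q y * volume            ≤⟨ *-monoʳ-≤ (q y) (≤ᵇ⇒≤ volume (L * n * deg y) (highs {1} (s≤s z≤n) (s≤s (s≤s z≤n)))) ⟩
        q y * (L * n * deg y)   ≡⟨ solve 3 (λ a b c → a :* (b :* c) := b :* (a :* c)) refl (q y) (L * n) (deg y) ⟩
        L * n * (q y * deg y)   ≤⟨ *-monoʳ-≤ (L * n) (q*deg≤P y) ⟩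
        L * n * P               ∎

-- Path families with boundedly many paths between two ends.

at-take : ∀ {A : Set} (d : A) k p {i} → i < k → at d (take k p) i ≡ at d p i
at-take d (suc k) []      _                 = refl
at-take d (suc k) (x ∷ p) {zero}  _         = refl
at-take d (suc k) (x ∷ p) {suc i} (s≤s i<k) = at-take d k p i<k

at-drop : ∀ {A : Set} (d : A) p i → at d (drop 1 p) i ≡ at d p (suc i)
at-drop d []      i = refl
at-drop d (x ∷ p) i = refl

at-drops : ∀ {A : Set} (d : A) j p i → at d (drop j p) i ≡ at d p (j + i)
at-drops d zero    p       i = refl
at-drops d (suc j) []      i = refl
at-drops d (suc j) (x ∷ p) i = at-drops d j p i

T-does : ∀ {A : Set} (a? : Dec A) → T (does a?) → A
T-does (yes a) _ = a

interior : ℕ → List ℕ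
interior ℓ = map (suc ∘ toℕ) (allFin (ℓ ∸ 1))

∈-interior⁺ : ∀ {ℓ i} → 0 < i → i < ℓ → i ∈ interior ℓ
∈-interior⁺ {suc ℓ} {suc i} _ (s≤s i<ℓ) =
  subst (_∈ interior (suc ℓ)) (cong suc (toℕ-fromℕ< i<ℓ)) (∈-map⁺ (suc ∘ toℕ) (∈-allFin (fromℕ< i<ℓ)))

-- The product counts a vertex of the attached set, its interior position, and the two pieces of the
-- path cut there. The first summand lets one bound serve all smaller lengths too.
pathBound : ℕ → ℕ → ℕ
pathBound h zero          = 1
pathBound h (suc zero)    = 1
pathBound h (suc (suc m)) = pathBound h (suc m) + h * (suc m * (pathBound h (suc m) * pathBound h (suc m)))

-- The two subpaths obtained by omitting an end give the factor 2; `3 + m` counts one loss for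
-- coinciding ends and one for each of `2 + m` step constraints.
lossBound : ℕ → ℕ
lossBound zero          = 1
lossBound (suc zero)    = 2
lossBound (suc (suc m)) = 2 * lossBound (suc m) + (3 + m)

module Families {n : ℕ} (G : Graph n) (d : Fin n) (L h : ℕ) where
  open Graph G
  open Sequences n
  open Weights G d hiding (high; hits)
  open DecMembership (_≟_ {n}) using (_∈?_)

  Seq : Set
  Seq = List (Fin n)

  high : Fin n → Bool
  high = Weights.high G d L

  hits : ℕ → (Fin n → Seq) → Seq → Bool
  hits = Weights.hits G d L

  -- The constraint i < ℓ concerns the vertex after position i, given those at positions 0 and i; the
  -- constraint i = ℓ concerns the interior of a path between given ends.
  probes : ℕ → ℕ → List ℕ
  probes ℓ i = if does (i ≟ᴺ ℓ) then interior ℓ else suc i ∷ []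

  probes-end : ∀ ℓ → probes ℓ ℓ ≡ interior ℓ
  probes-end ℓ = cong (λ b → if b then interior ℓ else suc ℓ ∷ []) (dec-true (ℓ ≟ᴺ ℓ) refl)

  probes-step : ∀ {ℓ i} → i < ℓ → probes ℓ i ≡ suc i ∷ []
  probes-step {ℓ} {i} i<ℓ = cong (λ b → if b then interior ℓ else suc i ∷ []) (dec-false (i ≟ᴺ ℓ) (<⇒≢ i<ℓ))

  Touches : Seq → Seq → List ℕ → Set
  Touches S p = Any (λ j → at d p j ∈ S)

  touches? : ∀ S p js → Dec (Touches S p js)
  touches? S p = Any.any? (λ j → at d p j ∈? S)

  key : ∀ ℓ → Fin (suc ℓ) → Seq → Fin n × Fin n
  key ℓ c p = at d p 0 , at d p (toℕ c)

  module Prune (ℓ : ℕ) = Pruning (≡-dec _≟_ _≟_) (key ℓ)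
    {Hit = λ c S p → Touches S p (probes ℓ (toℕ c))} (λ c S p → touches? S p (probes ℓ (toℕ c))) (sequences h)

  default : ∃ λ S → S ∈ sequences h
  default = replicate h d , subst (λ k → replicate h d ∈ sequences k) (length-replicate h) (∈-sequences⁺ _)

  -- If both subpaths have distinct vertices, only the two ends could still coincide.
  base : (Seq → Bool) → ℕ → Seq → Bool
  base F m p = (F (take (2 + m) p) ∧ F (drop 1 p)) ∧ not (does (at d p 0 ≟ at d p (2 + m)))

  baseList : (Seq → Bool) → ℕ → List Seq
  baseList F m = filter (λ p → T? (base F m p)) (sequences (3 + m))

  Outcome : (Seq → Bool) → ℕ → Set
  Outcome F m = Prune.RobustIn (2 + m) (baseList F m) ⊎ Prune.Cover (2 + m) (baseList F m)

  outcome : ∀ F m → Outcome F m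
  outcome F m = Prune.prune (2 + m) default (suc (length (baseList F m))) (baseList F m) ≤-refl

  -- In the robust case the set is empty, a default value; that case is excluded when `G` contains
  -- no copy of `H`.
  selected : ∀ F m → Outcome F m → Fin (3 + m) → Fin n → Fin n → Seq
  selected F m (inj₁ _)   c x v = []
  selected F m (inj₂ cov) c x v = Prune.Cover.σ cov c (x , v)

  selected≤h : ∀ F m (o : Outcome F m) c x v → length (selected F m o c x v) ≤ h
  selected≤h F m (inj₁ _)   c x v = z≤n
  selected≤h F m (inj₂ cov) c x v = ≤-reflexive (∈-sequences⁻ h (Prune.Cover.σ∈ cov c (x , v)))

  ends : (Seq → Bool) → ∀ m → Fin n → Fin n → Seq
  ends F m = selected F m (outcome F m) (fromℕ (2 + m))

  endsHit : (Seq → Bool) → ℕ → Seq → Bool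
  endsHit F m p = does (touches? (ends F m (at d p 0) (at d p (2 + m))) p (interior (2 + m)))

  -- The constraint on the ends is what allows paths to be cut and counted; paths covered only by a
  -- step constraint are discarded as lost weight.
  A : ℕ → Seq → Bool
  A 0             p = high (at d p 0)
  A 1             p = (A 0 (take 1 p) ∧ A 0 (drop 1 p)) ∧ does (at d p 0 ~? at d p 1)
  A (suc (suc m)) p = base (A (suc m)) m p ∧ endsHit (A (suc m)) m p

  split : ∀ {a b} → T (a ∧ b) → T a × T b
  split = Equivalence.to T-∧

  A-base : ∀ m p → T (A (2 + m) p) → T (base (A (1 + m)) m p)
  A-base m p = proj₁ ∘ split {base (A (1 + m)) m p}

  base-init : ∀ F m p → T (base F m p) → T (F (take (2 + m) p))
  base-init F m p = proj₁ ∘ split {F (take (2 + m) p)} ∘ proj₁ ∘ split {F (take (2 + m) p) ∧ F (drop 1 p)}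

  base-tail : ∀ F m p → T (base F m p) → T (F (drop 1 p))
  base-tail F m p = proj₂ ∘ split {F (take (2 + m) p)} ∘ proj₁ ∘ split {F (take (2 + m) p) ∧ F (drop 1 p)}

  base-open : ∀ F m p → T (base F m p) → at d p 0 ≢ at d p (2 + m)
  base-open F m p b = T-does (¬? (at d p 0 ≟ at d p (2 + m))) (proj₂ (split {F (take (2 + m) p) ∧ F (drop 1 p)} b))

  A-init : ∀ ℓ p → T (A (suc ℓ) p) → T (A ℓ (take (suc ℓ) p))
  A-init zero    p = proj₁ ∘ split {A 0 (take 1 p)} ∘ proj₁ ∘ split {A 0 (take 1 p) ∧ A 0 (drop 1 p)}
  A-init (suc m) p = base-init (A (suc m)) m p ∘ A-base m p

  A-tail : ∀ ℓ p → T (A (suc ℓ) p) → T (A ℓ (drop 1 p))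
  A-tail zero    p = proj₂ ∘ split {A 0 (take 1 p)} ∘ proj₁ ∘ split {A 0 (take 1 p) ∧ A 0 (drop 1 p)}
  A-tail (suc m) p = base-tail (A (suc m)) m p ∘ A-base m p

  A-high : ∀ ℓ p {i} → i ≤ ℓ → T (A ℓ p) → T (high (at d p i))
  A-high zero    p z≤n a = a
  A-high (suc ℓ) p {zero}  _         a =
    subst (T ∘ high) (at-take d (suc ℓ) p (s≤s z≤n)) (A-high ℓ (take (suc ℓ) p) z≤n (A-init ℓ p a))
  A-high (suc ℓ) p {suc i} (s≤s i≤ℓ) a =
    subst (T ∘ high) (at-drop d p i) (A-high ℓ (drop 1 p) i≤ℓ (A-tail ℓ p a))

  Walk : ℕ → (Seq → Bool) → Set
  Walk ℓ F = ∀ p → T (F p) →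
    (∀ {i} → i < ℓ → at d p i ~ at d p (suc i)) ×
    (∀ {i j} → i < j → j ≤ ℓ → at d p i ≢ at d p j)

  base-walk : ∀ F m → Walk (1 + m) F → Walk (2 + m) (base F m)
  base-walk F m walk p b = steps , distinct
    where
    init = walk (take (2 + m) p) (base-init F m p b)
    tail = walk (drop 1 p) (base-tail F m p b)

    steps : ∀ {i} → i < 2 + m → at d p i ~ at d p (suc i)
    steps {zero}  _         =
      subst₂ _~_ (at-take d (2 + m) p (s≤s z≤n)) (at-take d (2 + m) p (s≤s (s≤s z≤n))) (proj₁ init (s≤s z≤n))
    steps {suc i} (s≤s i<m) = subst₂ _~_ (at-drop d p i) (at-drop d p (suc i)) (proj₁ tail i<m)

    distinct : ∀ {i j} → i < j → j ≤ 2 + m → at d p i ≢ at d p j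
    distinct {suc i} {suc j} (s≤s i<j) (s≤s j≤m) =
      subst₂ _≢_ (at-drop d p i) (at-drop d p j) (proj₂ tail i<j j≤m)
    distinct {zero} {j} 0<j j≤ with j ≟ᴺ 2 + m
    ... | yes refl = base-open F m p b
    ... | no  j≢   = subst₂ _≢_ (at-take d (2 + m) p (s≤s z≤n)) (at-take d (2 + m) p j<)
      (proj₂ init 0<j (≤-pred j<))
      where j< = ≤∧≢⇒< j≤ j≢

  A-walk : ∀ m → Walk (1 + m) (A (1 + m))
  A-walk zero p a = (λ { (s≤s z≤n) → edge }) , λ { (s≤s z≤n) (s≤s z≤n) eq → ~-irrefl eq edge }
    where edge = T-does (at d p 0 ~? at d p 1) (proj₂ (split {A 0 (take 1 p) ∧ A 0 (drop 1 p)} a))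
  A-walk (suc m) p a = base-walk (A (1 + m)) m (A-walk m) p (A-base m p a)

  ∈-baseList⁻ : ∀ F m {p} → p ∈ baseList F m → T (base F m p)
  ∈-baseList⁻ F m p∈ = proj₂ (∈-filter⁻ (λ p → T? (base F m p)) {xs = sequences (3 + m)} p∈)

  -- Every key records position 0, so replacements keep the first vertex, and the paths that start
  -- where `p₀` does form a family with one root.
  robustPaths : ∀ m → Prune.RobustIn (2 + m) (baseList (A (1 + m)) m) → RobustPaths G (2 + m) h
  robustPaths m (qs , qs⊆ , (p₀ , p₀∈) , robust) = record
    { Path        = ∃ λ p → p ∈ qs × at d p 0 ≡ at d p₀ 0
    ; at          = λ p → at d (proj₁ p)
    ; root        = at d p₀ 0
    ; path        = p₀ , p₀∈ , refl
    ; at-0        = λ p → proj₂ (proj₂ p)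
    ; at-step     = λ (p , p∈ , _) → proj₁ (walk p p∈)
    ; at-distinct = λ (p , p∈ , _) → proj₂ (walk p p∈)
    ; extend      = extend
    ; return      = return
    }
    where
    ℓ = 2 + m

    walk : ∀ p → p ∈ qs →
      (∀ {i} → i < ℓ → at d p i ~ at d p (suc i)) × (∀ {i j} → i < j → j ≤ ℓ → at d p i ≢ at d p j)
    walk p p∈ = base-walk (A (1 + m)) m (A-walk m) p (∈-baseList⁻ (A (1 + m)) m (qs⊆ p∈))

    candidate : ∀ (S : Fin h → Fin n) → tabulate S ∈ sequences h
    candidate S = subst (λ k → tabulate S ∈ sequences k) (length-tabulate S) (∈-sequences⁺ (tabulate S))

    avoid : ∀ p → p ∈ qs → ∀ {i} → i ≤ ℓ → (S : Fin h → Fin n) →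
      ∃ λ p′ → p′ ∈ qs × at d p′ 0 ≡ at d p 0 × at d p′ i ≡ at d p i × ¬ Touches (tabulate S) p′ (probes ℓ i)
    avoid p p∈ {i} i≤ℓ S with robust p∈ (fromℕ< (s≤s i≤ℓ)) (candidate S)
    ... | p′ , p′∈ , key≡ , ¬touch = p′ , p′∈ , cong proj₁ key≡
        , subst (λ j → at d p′ j ≡ at d p j) toℕ≡ (cong proj₂ key≡)
        , subst (λ j → ¬ Touches (tabulate S) p′ (probes ℓ j)) toℕ≡ ¬touch
      where toℕ≡ = toℕ-fromℕ< (s≤s i≤ℓ)

    Path = ∃ λ p → p ∈ qs × at d p 0 ≡ at d p₀ 0

    extend : (p : Path) → ∀ {i} → i < ℓ → (S : Fin h → Fin n) →
      ∃ λ (p′ : Path) → at d (proj₁ p′) i ≡ at d (proj₁ p) i × (∀ t → S t ≢ at d (proj₁ p′) (suc i))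
    extend (p , p∈ , at0) i<ℓ S with avoid p p∈ (<⇒≤ i<ℓ) S
    ... | p′ , p′∈ , same0 , samei , ¬touch = (p′ , p′∈ , trans same0 at0) , samei ,
      λ t eq → ¬touch (subst (Touches (tabulate S) p′) (sym (probes-step i<ℓ))
        (here (subst (_∈ tabulate S) eq (∈-tabulate⁺ t))))

    return : (p : Path) → (S : Fin h → Fin n) →
      ∃ λ (p′ : Path) → at d (proj₁ p′) ℓ ≡ at d (proj₁ p) ℓ ×
        (∀ {i} → 0 < i → i < ℓ → ∀ t → S t ≢ at d (proj₁ p′) i)
    return (p , p∈ , at0) S with avoid p p∈ {ℓ} ≤-refl S
    ... | p′ , p′∈ , same0 , sameℓ , ¬touch = (p′ , p′∈ , trans same0 at0) , sameℓ ,
      λ 0<i i<ℓ t eq → ¬touch (subst (Touches (tabulate S) p′) (sym (probes-end ℓ))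
        (lose (∈-interior⁺ 0<i i<ℓ) (subst (_∈ tabulate S) eq (∈-tabulate⁺ t))))

  covered : ∀ F m (o : Outcome F m) → ¬ Prune.RobustIn (2 + m) (baseList F m) →
    ∀ {p} → p ∈ baseList F m →
    Touches (selected F m o (fromℕ (2 + m)) (at d p 0) (at d p (2 + m))) p (interior (2 + m)) ⊎
    ∃ λ (c : Fin (3 + m)) → toℕ c < 2 + m × at d p (suc (toℕ c)) ∈ selected F m o c (at d p 0) (at d p (toℕ c))
  covered F m (inj₁ rob) ¬rob p∈ = contradiction rob ¬rob
  covered F m (inj₂ cov) ¬rob {p} p∈ with Prune.Cover.covering cov p∈
  ... | c , touch with toℕ c ≟ᴺ 2 + m
  ...   | yes eq with refl ← toℕ-injective {i = c} {j = fromℕ (2 + m)} (trans eq (sym (toℕ-fromℕ (2 + m)))) =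
    inj₁ (subst₂ (λ j js → Touches (Prune.Cover.σ cov c (at d p 0 , at d p j)) p js) eq
      (trans (cong (probes (2 + m)) eq) (probes-end (2 + m))) touch)
  ...   | no  neq with subst (Touches _ p) (probes-step c<) touch
    where c< = ≤∧≢⇒< (≤-pred (toℕ<n c)) neq
  ...     | here at∈ = inj₂ (c , ≤∧≢⇒< (≤-pred (toℕ<n c)) neq , at∈)

  A-take : ∀ j e p → length p ≡ suc (e + j) → T (A (e + j) p) → T (A j (take (suc j) p))
  A-take j zero    p len a = subst (T ∘ A j) (sym (take-all (suc j) p (≤-reflexive len))) a
  A-take j (suc e) p len a = subst (T ∘ A j)
    (trans (take-take (suc j) (suc (e + j)) p) (cong (λ k → take k p) (m≤n⇒m⊓n≡m (s≤s (m≤n+m j e)))))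
    (A-take j e (take (suc (e + j)) p)
      (trans (length-take (suc (e + j)) p) (m≤n⇒m⊓n≡m (≤-trans (n≤1+n _) (≤-reflexive (sym len)))))
      (A-init (e + j) p a))

  A-drop : ∀ i e p → T (A (i + e) p) → T (A e (drop i p))
  A-drop zero    e p a = a
  A-drop (suc i) e p a = subst (T ∘ A e) (drop-drop 1 i p) (A-drop i e (drop 1 p) (A-tail (i + e) p a))

  Enumeration : ℕ → ℕ → Fin n → Fin n → Set
  Enumeration c ℓ x v = ∃ λ (ps : List Seq) → length ps ≤ c ×
    (∀ {p} → length p ≡ suc ℓ → T (A ℓ p) → at d p 0 ≡ x → at d p ℓ ≡ v → p ∈ ps)

  -- A path in A (2 + m) is cut where it meets the set attached to its pair of ends.
  enumerate-step : ∀ m c → (∀ {j} → j ≤ 1 + m → ∀ x v → Enumeration c j x v) →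
                   ∀ x v → Enumeration (h * (suc m * (c * c))) (2 + m) x v
  enumerate-step m c enum x v = concatMap via S , size , complete
    where
    S : Seq
    S = ends (A (1 + m)) m x v

    glue : Seq → Seq → Seq
    glue p q = p ++ drop 1 q

    -- The cut is at position `suc (toℕ i)`, so both pieces have between 1 and `suc m` edges and are
    -- counted already; `glue` drops the repeated cut vertex.
    left : ∀ s (i : Fin (suc m)) → Enumeration c (suc (toℕ i)) x s
    left s i = enum (s≤s (toℕ≤pred[n] i)) x s

    right : ∀ s (i : Fin (suc m)) → Enumeration c (suc m ∸ toℕ i) s v
    right s i = enum (m∸n≤m (suc m) (toℕ i)) s v

    cut : Fin n → Fin (suc m) → List Seq
    cut s i = cartesianProductWith glue (proj₁ (left s i)) (proj₁ (right s i))

    via : Fin n → List Seq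
    via s = concatMap (cut s) (allFin (suc m))

    size : length (concatMap via S) ≤ h * (suc m * (c * c))
    size = begin
      length (concatMap via S)
        ≤⟨ length-concatMap≤ via S (λ {s} _ → length-concatMap≤ (cut s) (allFin (suc m)) (λ {i} _ → cut≤ s i)) ⟩
      length S * (length (allFin (suc m)) * (c * c))
        ≡⟨ cong (λ k → length S * (k * (c * c))) (length-tabulate {n = suc m} (λ i → i)) ⟩
      length S * (suc m * (c * c))
        ≤⟨ *-monoˡ-≤ (suc m * (c * c)) (selected≤h (A (1 + m)) m (outcome (A (1 + m)) m) _ x v) ⟩
      h * (suc m * (c * c)) ∎
      where
      open ≤-Reasoning
      cut≤ : ∀ s i → length (cut s i) ≤ c * c
      cut≤ s i = ≤-trans (≤-reflexive (length-cartesianProductWith glue (proj₁ (left s i)) (proj₁ (right s i))))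
        (*-mono-≤ (proj₁ (proj₂ (left s i))) (proj₁ (proj₂ (right s i))))

    complete : ∀ {p} → length p ≡ 3 + m → T (A (2 + m) p) → at d p 0 ≡ x → at d p (2 + m) ≡ v → p ∈ concatMap via S
    complete {p} len a refl refl
      with find (T-does (touches? S p (interior (2 + m))) (proj₂ (split {base (A (1 + m)) m p} a)))
    ... | j , j∈ , s∈ with ∈-map⁻ (suc ∘ toℕ) {xs = allFin (suc m)} j∈
    ...   | i , i∈ , refl = ∈-concatMap⁺ via (lose s∈ (∈-concatMap⁺ (cut s) (lose i∈
      (subst (_∈ cut s i) glue≡ (∈-cartesianProductWith⁺ glue prefix∈ suffix∈)))))
      where
      s = at d p (suc (toℕ i))
      j′ = suc (toℕ i)
      e  = suc m ∸ toℕ i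

      j+e : j′ + e ≡ 2 + m
      j+e = cong suc (m+[n∸m]≡n (≤-trans (toℕ≤pred[n] i) (n≤1+n m)))

      e+j : e + j′ ≡ 2 + m
      e+j = trans (+-comm e j′) j+e

      prefix∈ : take (suc j′) p ∈ proj₁ (left s i)
      prefix∈ = proj₂ (proj₂ (left s i))
        (trans (length-take (suc j′) p) (m≤n⇒m⊓n≡m (subst (suc j′ ≤_) (sym len) (s≤s (s≤s (<⇒≤ (toℕ<n i)))))))
        (A-take j′ e p (trans len (cong suc (sym e+j))) (subst (λ k → T (A k p)) (sym e+j) a))
        (at-take d (suc j′) p (s≤s z≤n))
        (at-take d (suc j′) p ≤-refl)

      suffix∈ : drop j′ p ∈ proj₁ (right s i)
      suffix∈ = proj₂ (proj₂ (right s i))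
        (trans (length-drop j′ p) (trans (cong (_∸ j′) (trans len (cong suc (sym e+j)))) (m+n∸n≡m (suc e) j′)))
        (A-drop j′ e p (subst (λ k → T (A k p)) (sym j+e) a))
        (trans (at-drops d j′ p 0) (cong (at d p) (+-identityʳ j′)))
        (trans (at-drops d j′ p e) (cong (at d p) j+e))

      glue≡ : glue (take (suc j′) p) (drop j′ p) ≡ p
      glue≡ = trans (cong (take (suc j′) p ++_) (trans (drop-drop j′ 1 p) (cong (λ k → drop k p) (+-comm j′ 1))))
        (take++drop≡id (suc j′) p)

  N : ℕ → ℕ
  N = pathBound h

  Enumeration-≤ : ∀ {c c′ ℓ x v} → c ≤ c′ → Enumeration c ℓ x v → Enumeration c′ ℓ x v
  Enumeration-≤ c≤ (ps , len , complete) = ps , ≤-trans len c≤ , complete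

  Enumerations : ℕ → Set
  Enumerations ℓ = ∀ {j} → j ≤ ℓ → ∀ x v → Enumeration (N ℓ) j x v

  enumerate-suc : ∀ ℓ → Enumerations ℓ → Enumerations (suc ℓ)
  enumerate-suc zero    enum {zero}        _        x v = enum z≤n x v
  enumerate-suc zero    enum {suc zero}    _        x v =
    (x ∷ v ∷ []) ∷ [] , ≤-refl , λ { {_ ∷ _ ∷ []} _ _ refl refl → here refl }
  enumerate-suc zero    enum {suc (suc _)} (s≤s ())
  enumerate-suc (suc m) enum {j}           j≤       x v with j ≟ᴺ 2 + m
  ... | yes refl = Enumeration-≤ (m≤n+m _ (N (suc m))) (enumerate-step m (N (suc m)) enum x v)
  ... | no  j≢   = Enumeration-≤ (m≤m+n (N (suc m)) _) (enum (≤-pred (≤∧≢⇒< j≤ j≢)) x v)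

  enumerate : ∀ ℓ → Enumerations ℓ
  enumerate zero    z≤n x v = (x ∷ []) ∷ [] , ≤-refl , λ { {_ ∷ []} _ _ refl _ → here refl }
  enumerate (suc ℓ) = enumerate-suc ℓ (enumerate ℓ)

  length-A : ∀ ℓ → ∑ (sequences (suc ℓ)) (λ p → 𝟙 (A ℓ p)) ≤ n * (n * N ℓ)
  length-A ℓ = begin
    ∑ (sequences (suc ℓ)) (λ p → 𝟙 (A ℓ p))       ≡⟨ length-filter≡∑ A? (sequences (suc ℓ)) ⟨
    length (filter A? (sequences (suc ℓ)))        ≤⟨ unique-⊆-length (filter⁺ A? (sequences-unique (suc ℓ))) listed ⟩
    length all                                    ≤⟨ length-concatMap≤ _ vertices (λ {x} _ →
                                                       length-concatMap≤ (list x) vertices λ {v} _ →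
                                                       proj₁ (proj₂ (enumerate ℓ ≤-refl x v))) ⟩
    length vertices * (length vertices * N ℓ)     ≡⟨ cong (λ k → k * (k * N ℓ)) (length-tabulate {n = n} (λ i → i)) ⟩
    n * (n * N ℓ)                                 ∎
    where
    open ≤-Reasoning
    A? = λ p → T? (A ℓ p)

    list : Fin n → Fin n → List Seq
    list x v = proj₁ (enumerate ℓ ≤-refl x v)

    all : List Seq
    all = concatMap (λ x → concatMap (list x) vertices) vertices

    listed : ∀ {p} → p ∈ filter A? (sequences (suc ℓ)) → p ∈ all
    listed {p} p∈ with ∈-filter⁻ A? {xs = sequences (suc ℓ)} p∈
    ... | p∈′ , a = ∈-concatMap⁺ (λ x → concatMap (list x) vertices) (lose (∈-allFin (at d p 0))
      (∈-concatMap⁺ (list (at d p 0)) (lose (∈-allFin (at d p ℓ))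
        (proj₂ (proj₂ (enumerate ℓ ≤-refl (at d p 0) (at d p ℓ))) (∈-sequences⁻ (suc ℓ) p∈′) a refl refl))))

  -- The number of paths from `length-A` times the bound on a single weight, which applies because
  -- all vertices of these paths are high.
  mass-A : ∀ ℓ → mass (suc ℓ) (A (suc ℓ)) * volume ^ ℓ ≤ n * (n * N (suc ℓ)) * ((L * n * P) ^ ℓ * P)
  mass-A ℓ = begin
    mass (suc ℓ) (A (suc ℓ)) * volume ^ ℓ
      ≡⟨ ∑-*ʳ (sequences (2 + ℓ)) _ (volume ^ ℓ) ⟨
    ∑ (sequences (2 + ℓ)) (λ p → weight p * 𝟙 (A (suc ℓ) p) * volume ^ ℓ)
      ≤⟨ ∑-mono (sequences (2 + ℓ)) (λ {p} p∈ → bound p (∈-sequences⁻ (2 + ℓ) p∈)) ⟩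
    ∑ (sequences (2 + ℓ)) (λ p → 𝟙 (A (suc ℓ) p) * M)
      ≡⟨ ∑-*ʳ (sequences (2 + ℓ)) _ M ⟩
    ∑ (sequences (2 + ℓ)) (λ p → 𝟙 (A (suc ℓ) p)) * M
      ≤⟨ *-monoˡ-≤ M (length-A (suc ℓ)) ⟩
    n * (n * N (suc ℓ)) * M ∎
    where
    open ≤-Reasoning
    M = (L * n * P) ^ ℓ * P

    bound : ∀ p → length p ≡ 2 + ℓ → weight p * 𝟙 (A (suc ℓ) p) * volume ^ ℓ ≤ 𝟙 (A (suc ℓ) p) * M
    bound p len with A (suc ℓ) p in a
    bound p@(x ∷ y ∷ r) refl | true = begin
      weight p * 1 * volume ^ ℓ  ≡⟨ cong (_* volume ^ ℓ) (*-identityʳ (weight p)) ⟩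
      weight p * volume ^ ℓ      ≤⟨ weight≤ L x y r (λ _ i< → A-high (suc ℓ) p (<⇒≤ i<) (subst T (sym a) tt)) ⟩
      M                          ≡⟨ *-identityˡ M ⟨
      1 * M                      ∎
    ... | false = ≤-reflexive (cong (_* volume ^ ℓ) (*-zeroʳ (weight p)))

  -- Weight lost in passing to the families.

  -- Coinciding ends are expressed as a last step into a one-element set, so that `mass-hits`
  -- applies.
  closedAt : ℕ → Seq → Bool
  closedAt m p = hits (1 + m) (λ _ → at d p 0 ∷ []) p

  stepHit : ∀ m → Fin (2 + m) → Seq → Bool
  stepHit m c p = hits (toℕ c) (selected F m (outcome F m) (inject₁ c) (at d p 0)) p
    where F = A (1 + m)

  T⇒1≤𝟙 : ∀ {b} → T b → 1 ≤ 𝟙 b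
  T⇒1≤𝟙 {true} _ = ≤-refl

  T-high-hit : ∀ i S p → T (high (at d p i)) → at d p (suc i) ∈ S (at d p i) → T (hits i S p)
  T-high-hit i S p hi ∈S = Equivalence.from T-∧ (hi , subst T (sym (dec-true (_ ∈? _) ∈S)) tt)

  -- A sequence outside the family fails in one of its two subpaths, has coinciding ends, or is a
  -- base path not hit through its ends, which the cover then hits in some step.
  not-A≤ : ∀ m → ¬ Prune.RobustIn (2 + m) (baseList (A (1 + m)) m) → ∀ {p} → p ∈ sequences (3 + m) →
    𝟙 (not (A (2 + m) p)) ≤
    𝟙 (not (A (1 + m) (take (2 + m) p))) + (𝟙 (not (A (1 + m) (drop 1 p))) +
      (𝟙 (closedAt m p) + ∑ (allFin (2 + m)) (λ c → 𝟙 (stepHit m c p))))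
  not-A≤ m ¬rob {p} p∈ with A (1 + m) (take (2 + m) p) in init | A (1 + m) (drop 1 p) in tail
  ... | false | _     = ≤-trans (𝟙≤1 (not false)) (s≤s z≤n)
  ... | true  | false = s≤s z≤n
  ... | true  | true with at d p 0 ≟ at d p (2 + m) in open?
  ...   | yes closed = ≤-trans (T⇒1≤𝟙 closed′) (m≤m+n _ _)
    where
    closed′ : T (closedAt m p)
    closed′ = T-high-hit (1 + m) (λ _ → at d p 0 ∷ []) p
      (subst (T ∘ high) (at-take d (2 + m) p ≤-refl) (A-high (1 + m) (take (2 + m) p) ≤-refl (subst T (sym init) tt)))
      (here (sym closed))
  ...   | no ¬closed with covered F m (outcome F m) ¬rob (∈-filter⁺ (λ p → T? (base F m p)) p∈ base-p)
    where
    F = A (1 + m)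
    base-p : T (base F m p)
    base-p = subst T (sym (cong₂ _∧_ (cong₂ _∧_ init tail) (cong (not ∘ does) open?))) tt
  ...     | inj₁ hit = ≤-trans (≤-reflexive (cong (𝟙 ∘ not) (dec-true (touches? _ p _) hit))) z≤n
  ...     | inj₂ (c , c< , ∈S) = ≤-trans (≤-trans (𝟙≤1 _) (T⇒1≤𝟙 step))
            (≤-trans (∈⇒≤∑ (λ c → 𝟙 (stepHit m c p)) (∈-allFin (fromℕ< c<))) (m≤n+m _ (𝟙 (closedAt m p))))
    where
    F = A (1 + m)
    c≡ : inject₁ (fromℕ< c<) ≡ c
    c≡ = toℕ-injective (trans (toℕ-inject₁ (fromℕ< c<)) (toℕ-fromℕ< c<))

    high-c : T (high (at d p (toℕ c)))
    high-c = subst (T ∘ high) (at-take d (2 + m) p c<)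
      (A-high (1 + m) (take (2 + m) p) (≤-pred c<) (subst T (sym init) tt))

    step : T (stepHit m (fromℕ< c<) p)
    step = subst₂ (λ i c → T (hits i (selected F m (outcome F m) c (at d p 0)) p)) (sym (toℕ-fromℕ< c<)) (sym c≡)
      (T-high-hit (toℕ c) (selected F m (outcome F m) c (at d p 0)) p high-c ∈S)

  module Dense .{{_ : NonZero n}} .{{_ : NonZero volume}} (dense : suc h * (L * n) * L ≤ volume) where

    -- Density turns the probability from `mass-hits` into at most 1 / `L`. The size `suc h`
    -- accommodates both the selected sets and the one-element set in `closedAt`.
    light : ∀ (S : Fin n → Fin n → Seq) → (∀ x v → length (S x v) ≤ suc h) → ∀ {m i} → i < m →
            L * mass m (λ p → hits i (S (at d p 0)) p) ≤ total m
    light S S≤ {m} {i} i<m = *-cancelˡ-≤ volume (begin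
      volume * (L * μ)                    ≡⟨ solve 3 (λ a b c → a :* (b :* c) := a :* c :* b) refl volume L μ ⟩
      volume * μ * L                      ≤⟨ *-monoˡ-≤ L (mass-hits L S S≤ i<m) ⟩
      suc h * (L * n) * total m * L       ≡⟨ solve 3 (λ a b c → a :* b :* c := a :* c :* b) refl
                                               (suc h * (L * n)) (total m) L ⟩
      suc h * (L * n) * L * total m       ≤⟨ *-monoˡ-≤ (total m) dense ⟩
      volume * total m                    ∎)
      where
      open ≤-Reasoning
      μ = mass m (λ p → hits i (S (at d p 0)) p)

    Loss : ℕ → Set
    Loss ℓ = L * mass ℓ (not ∘ A ℓ) ≤ lossBound ℓ * total ℓ

    P*total : ∀ m → P * total m ≡ total (suc m)
    P*total m = solve 3 (λ a b c → a :* (b :* c) := b :* (a :* c)) refl P volume (P ^ m)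

    L*P* : ∀ {μ c} m → L * μ ≤ c * total m → L * (P * μ) ≤ c * total (suc m)
    L*P* {μ} {c} m bound = begin
      L * (P * μ)          ≡⟨ solve 3 (λ a b c → a :* (b :* c) := b :* (a :* c)) refl L P μ ⟩
      P * (L * μ)          ≤⟨ *-monoʳ-≤ P bound ⟩
      P * (c * total m)    ≡⟨ solve 3 (λ a b c → a :* (b :* c) := b :* (a :* c)) refl P c (total m) ⟩
      c * (P * total m)    ≡⟨ cong (c *_) (P*total m) ⟩
      c * total (suc m)    ∎
      where open ≤-Reasoning

    loss-0 : Loss 0
    loss-0 = ≤-trans (mass-low L) (≤-reflexive (sym (*-identityˡ (total 0))))

    loss-1 : Loss 1
    loss-1 = begin
      L * mass 1 (not ∘ A 1)
        ≤⟨ *-monoʳ-≤ L (≤-trans (∑-mono (sequences 2) (λ {p} p∈ → split≤ p (∈-sequences⁻ 2 p∈)))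
             (≤-reflexive (∑-+ (sequences 2) _ _))) ⟩
      L * (mass 1 (not ∘ A 0 ∘ take 1) + mass 1 (not ∘ A 0 ∘ drop 1))
        ≤⟨ *-monoʳ-≤ L (+-mono-≤ (≤-reflexive (mass-take 0 (not ∘ A 0))) (mass-drop 0 (not ∘ A 0))) ⟩
      L * (P * μ + P * μ)
        ≡⟨ *-distribˡ-+ L _ _ ⟩
      L * (P * μ) + L * (P * μ)
        ≤⟨ +-mono-≤ (L*P* {μ} {1} 0 loss-0) (L*P* {μ} {1} 0 loss-0) ⟩
      1 * total 1 + 1 * total 1
        ≡⟨ *-distribʳ-+ (total 1) 1 1 ⟨
      2 * total 1 ∎
      where
      open ≤-Reasoning
      μ = mass 0 (not ∘ A 0)

      split≤ : ∀ p → length p ≡ 2 → weight p * 𝟙 (not (A 1 p)) ≤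
               weight p * 𝟙 (not (A 0 (take 1 p))) + weight p * 𝟙 (not (A 0 (drop 1 p)))
      split≤ (x ∷ y ∷ []) _ with high x | high y | does (x ~? y)
      ... | false | _     | _     = m≤m+n _ _
      ... | true  | false | _     = m≤n+m _ _
      ... | true  | true  | true  = ≤-trans (≤-reflexive (*-zeroʳ (1 * (q y * deg y)))) z≤n
      -- A pair of nonadjacent vertices has weight 0.
      ... | true  | true  | false = z≤n

    -- By stationarity each of the two subpaths costs the loss of the previous length; coinciding
    -- ends and each step constraint cost 1 / `L` of the total by `light`.
    loss-step : ∀ m → ¬ Prune.RobustIn (2 + m) (baseList (A (1 + m)) m) → Loss (1 + m) → Loss (2 + m)
    loss-step m ¬rob loss = begin
      L * mass (2 + m) (not ∘ A (2 + m))
        ≤⟨ *-monoʳ-≤ L (∑-mono seqs (λ {p} p∈ → *-monoʳ-≤ (weight p) (not-A≤ m ¬rob p∈))) ⟩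
      L * ∑ seqs (λ p → weight p * (f₁ p + (f₂ p + (f₃ p + f₄ p))))
        ≡⟨ cong (L *_) (∑-weight-+ f₁ (λ p → f₂ p + (f₃ p + f₄ p))) ⟩
      L * (M₁ + ∑ seqs (λ p → weight p * (f₂ p + (f₃ p + f₄ p))))
        ≡⟨ cong (λ k → L * (M₁ + k)) (∑-weight-+ f₂ (λ p → f₃ p + f₄ p)) ⟩
      L * (M₁ + (M₂ + ∑ seqs (λ p → weight p * (f₃ p + f₄ p))))
        ≡⟨ cong (λ k → L * (M₁ + (M₂ + k))) (∑-weight-+ f₃ f₄) ⟩
      L * (M₁ + (M₂ + (M₃ + M₄)))
        ≡⟨ solve 5 (λ l a b c e → l :* (a :+ (b :+ (c :+ e))) := l :* a :+ (l :* b :+ (l :* c :+ l :* e)))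
             refl L M₁ M₂ M₃ M₄ ⟩
      L * M₁ + (L * M₂ + (L * M₃ + L * M₄))
        ≤⟨ +-mono-≤ L*M₁ (+-mono-≤ L*M₂ (+-mono-≤ L*M₃ L*M₄)) ⟩
      c * t + (c * t + (t + (2 + m) * t))
        ≡⟨ solve 3 (λ a b e → a :* b :+ (a :* b :+ (b :+ (con 2 :+ e) :* b)) :=
                              (con 2 :* a :+ (con 3 :+ e)) :* b) refl c t m ⟩
      lossBound (2 + m) * t ∎
      where
      open ≤-Reasoning
      F = A (1 + m)
      seqs = sequences (3 + m)
      c = lossBound (1 + m)
      t = total (2 + m)

      f₁ f₂ f₃ f₄ : Seq → ℕ
      f₁ p = 𝟙 (not (F (take (2 + m) p)))
      f₂ p = 𝟙 (not (F (drop 1 p)))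
      f₃ p = 𝟙 (closedAt m p)
      f₄ p = ∑ (allFin (2 + m)) (λ c → 𝟙 (stepHit m c p))

      M₁ = mass (2 + m) (not ∘ F ∘ take (2 + m))
      M₂ = mass (2 + m) (not ∘ F ∘ drop 1)
      M₃ = mass (2 + m) (closedAt m)
      M₄ = ∑ seqs (λ p → weight p * f₄ p)

      ∑-weight-+ : ∀ (f g : Seq → ℕ) → ∑ seqs (λ p → weight p * (f p + g p)) ≡
                   ∑ seqs (λ p → weight p * f p) + ∑ seqs (λ p → weight p * g p)
      ∑-weight-+ f g = trans (∑-cong seqs λ {p} _ → *-distribˡ-+ (weight p) (f p) (g p)) (∑-+ seqs _ _)

      L*M₁ : L * M₁ ≤ c * t
      L*M₁ = ≤-trans (*-monoʳ-≤ L (≤-reflexive (mass-take (1 + m) (not ∘ F)))) (L*P* {c = c} (1 + m) loss)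

      L*M₂ : L * M₂ ≤ c * t
      L*M₂ = ≤-trans (*-monoʳ-≤ L (mass-drop (1 + m) (not ∘ F))) (L*P* {c = c} (1 + m) loss)

      L*M₃ : L * M₃ ≤ t
      L*M₃ = light (λ x _ → x ∷ []) (λ _ _ → s≤s z≤n) ≤-refl

      L*M₄ : L * M₄ ≤ (2 + m) * t
      L*M₄ = begin
        L * ∑ seqs (λ p → weight p * f₄ p)
          ≡⟨ cong (L *_) (trans (∑-cong seqs λ {p} _ → sym (∑-*ˡ (allFin (2 + m)) (weight p) _))
               (∑-swap seqs (allFin (2 + m)) _)) ⟩
        L * ∑ (allFin (2 + m)) (λ c → mass (2 + m) (stepHit m c))
          ≡⟨ ∑-*ˡ (allFin (2 + m)) L _ ⟨
        ∑ (allFin (2 + m)) (λ c → L * mass (2 + m) (stepHit m c))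
          ≤⟨ ∑-mono (allFin (2 + m)) (λ {c} _ → light (selected F m (outcome F m) (inject₁ c))
               (λ x v → m≤n⇒m≤1+n (selected≤h F m (outcome F m) (inject₁ c) x v)) (toℕ<n c)) ⟩
        ∑ (allFin (2 + m)) (λ _ → t)
          ≡⟨ trans (∑-const (allFin (2 + m)) t) (cong (_* t) (length-tabulate {n = 2 + m} (λ i → i))) ⟩
        (2 + m) * t ∎

    loss : ∀ m → (∀ {m′} → m′ < m → ¬ Prune.RobustIn (2 + m′) (baseList (A (1 + m′)) m′)) → Loss (1 + m)
    loss zero    _    = loss-1
    loss (suc m) ¬rob = loss-step m (¬rob ≤-refl) (loss m λ m′<m → ¬rob (m<n⇒m<1+n m′<m))

-- From the weight of paths to the extremal number.

edgeCount≤volume : ∀ {n} (G : Graph n) d → edgeCount G ≤ Weights.volume G d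
edgeCount≤volume {n} G d = begin
  edgeCount G
    ≡⟨ length-filter≡∑ (λ e → (proj₁ e <? proj₂ e) ×-dec (proj₁ e ~? proj₂ e)) pairs ⟩
  ∑ pairs (λ e → 𝟙 (does (proj₁ e <? proj₂ e) ∧ does (proj₁ e ~? proj₂ e)))
    ≤⟨ ∑-mono pairs (λ {e} _ → 𝟙-∧ (does (proj₁ e <? proj₂ e)) _) ⟩
  ∑ pairs (λ e → adj (proj₁ e) (proj₂ e))
    ≡⟨ ∑-cartesianProductWith _,_ (allFin n) (allFin n) _ ⟩
  volume ∎
  where
  open ≤-Reasoning
  open Graph G
  open Weights G d
  pairs = cartesianProduct (allFin n) (allFin n)

  𝟙-∧ : ∀ a b → 𝟙 (a ∧ b) ≤ 𝟙 b
  𝟙-∧ true  b = ≤-refl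
  𝟙-∧ false b = z≤n

lossBound-nonZero : ∀ ℓ → NonZero (lossBound ℓ)
lossBound-nonZero zero          = _
lossBound-nonZero (suc zero)    = _
lossBound-nonZero (suc (suc ℓ)) = >-nonZero (≤-trans (s≤s z≤n) (m≤n+m (3 + ℓ) (2 * lossBound (suc ℓ))))

m≤m^1+n : ∀ m n → m ≤ m ^ suc n
m≤m^1+n zero    n = z≤n
m≤m^1+n (suc m) n = m≤m*n (suc m) (suc m ^ n) {{m^n≢0 (suc m) n}}

^-distribʳ-* : ∀ o m n → (m * n) ^ o ≡ m ^ o * n ^ o
^-distribʳ-* zero    m n = refl
^-distribʳ-* (suc o) m n = trans (cong (m * n *_) (^-distribʳ-* o m n))
  (solve 4 (λ a b c e → a :* b :* (c :* e) := a :* c :* (b :* e)) refl m n (m ^ o) (n ^ o))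

module Bound {h : ℕ} (H : Graph h) (w : Fin h) (connected : Connected H) (bipartite : Bipartite H)
  (feedback : ∀ {m} (c : Cycle H m) → ¬ (∀ i → Cycle.vertex c i ≢ w))
  (κ : ℕ) (girth : ∀ {m} → Cycle H m → 2 * (2 + κ) ≤ m) where

  -- `L` makes the loss at length `k` at most half of the total. `C₂` is the average degree from
  -- which the weight argument applies, and `C₁` is the constant which that argument gives.
  k L C₁ C₂ C : ℕ
  k  = 2 + κ
  L  = 2 * lossBound k
  C₁ = 2 * pathBound h k * L ^ (1 + κ)
  C₂ = suc h * L * L
  C  = C₁ + C₂

  module _ {n : ℕ} (G : Graph (suc n)) (free : ¬ H ⊑ G) where
    open Sequences (suc n)
    open Weights G zero hiding (high; hits)
    open Families G zero L h

    -- The length `2 + m` is at most `k`, so the girth is at least twice this length and a robust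
    -- family would give a copy of `H`.
    notRobust : ∀ {m} → m < 1 + κ → ¬ Prune.RobustIn (2 + m) (baseList (A (1 + m)) m)
    notRobust {m} m<κ rob = free (Embedding.embedding H G w connected bipartite feedback m girth′ (robustPaths m rob))
      where
      girth′ : ∀ {l} → Cycle H l → suc (suc m) + suc (suc m) ≤ l
      girth′ c = ≤-trans (+-mono-≤ (s≤s m<κ) (≤-trans (s≤s m<κ) (≤-reflexive (sym (+-identityʳ k))))) (girth c)

    mass-complement : mass k (A k) + mass k (not ∘ A k) ≡ total k
    mass-complement = begin
      mass k (A k) + mass k (not ∘ A k)
        ≡⟨ ∑-+ (sequences (suc k)) _ _ ⟨
      ∑ (sequences (suc k)) (λ p → weight p * 𝟙 (A k p) + weight p * 𝟙 (not (A k p)))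
        ≡⟨ ∑-cong (sequences (suc k)) (λ {p} _ → either (weight p) (A k p)) ⟩
      ∑ (sequences (suc k)) weight
        ≡⟨ weight-total k ⟩
      total k ∎
      where
      open ≡-Reasoning
      either : ∀ m b → m * 𝟙 b + m * 𝟙 (not b) ≡ m
      either m true  = trans (cong₂ _+_ (*-identityʳ m) (*-zeroʳ m)) (+-identityʳ m)
      either m false = trans (cong₂ _+_ (*-zeroʳ m) (*-identityʳ m)) refl

    module _ .{{_ : NonZero volume}} (dense : suc h * (L * suc n) * L ≤ volume) where

      2*mass-loss≤total : 2 * mass k (not ∘ A k) ≤ total k
      2*mass-loss≤total = *-cancelˡ-≤ (lossBound k) {{lossBound-nonZero k}} (begin
        lossBound k * (2 * μ)    ≡⟨ solve 2 (λ a b → a :* (con 2 :* b) := con 2 :* a :* b) refl (lossBound k) μ ⟩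
        L * μ                    ≤⟨ Dense.loss dense (1 + κ) notRobust ⟩
        lossBound k * total k    ∎)
        where
        open ≤-Reasoning
        μ = mass k (not ∘ A k)

      total≤2*mass : total k ≤ 2 * mass k (A k)
      total≤2*mass = +-cancelʳ-≤ (total k) (total k) (2 * mass k (A k)) (begin
        total k + total k                                    ≡⟨ cong (total k +_) (+-identityʳ (total k)) ⟨
        2 * total k                                          ≡⟨ cong (2 *_) mass-complement ⟨
        2 * (mass k (A k) + mass k (not ∘ A k))              ≡⟨ *-distribˡ-+ 2 (mass k (A k)) _ ⟩
        2 * mass k (A k) + 2 * mass k (not ∘ A k)            ≤⟨ +-monoʳ-≤ (2 * mass k (A k)) 2*mass-loss≤total ⟩
        2 * mass k (A k) + total k                           ∎)
        where open ≤-Reasoning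

      -- At least half of `total k` lies on `A k`, where `mass-A` applies: two factors `suc n` come
      -- from the ends and `k - 1` from the interior, and `P ^ k` cancels.
      volume-dense : volume ^ k ≤ C₁ * suc n ^ (k + 1)
      volume-dense = *-cancelʳ-≤ (volume ^ k) _ (P ^ k) {{m^n≢0 P k {{suc n !≢0}}}} (begin
        volume ^ k * P ^ k
          ≡⟨ solve 3 (λ a b c → a :* b :* c := a :* c :* b) refl volume (volume ^ j) (P ^ k) ⟩
        total k * volume ^ j
          ≤⟨ *-monoˡ-≤ (volume ^ j) total≤2*mass ⟩
        2 * mass k (A k) * volume ^ j
          ≡⟨ *-assoc 2 (mass k (A k)) _ ⟩
        2 * (mass k (A k) * volume ^ j)
          ≤⟨ *-monoʳ-≤ 2 (mass-A j) ⟩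
        2 * (suc n * (suc n * N k) * ((L * suc n * P) ^ j * P))
          ≡⟨ cong (λ e → 2 * (suc n * (suc n * N k) * (e * P)))
               (trans (^-distribʳ-* j (L * suc n) P) (cong (_* P ^ j) (^-distribʳ-* j L (suc n)))) ⟩
        2 * (suc n * (suc n * N k) * (L ^ j * suc n ^ j * P ^ j * P))
          ≡⟨ solve 6 (λ a b c e f g → con 2 :* (a :* (a :* b) :* (c :* e :* f :* g)) :=
                                      con 2 :* b :* c :* (a :* (a :* e)) :* (g :* f))
               refl (suc n) (N k) (L ^ j) (suc n ^ j) (P ^ j) P ⟩
        C₁ * suc n ^ (1 + k) * P ^ k
          ≡⟨ cong (λ e → C₁ * suc n ^ e * P ^ k) (+-comm 1 k) ⟩
        C₁ * suc n ^ (k + 1) * P ^ k ∎)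
        where
        open ≤-Reasoning
        j = 1 + κ

    volume-sparse : volume ≤ suc h * (L * suc n) * L → volume ^ k ≤ C₂ ^ k * suc n ^ (k + 1)
    volume-sparse sparse = begin
      volume ^ k                       ≤⟨ ^-monoˡ-≤ k sparse ⟩
      (suc h * (L * suc n) * L) ^ k    ≡⟨ cong (_^ k) (solve 3 (λ a b c → a :* (b :* c) :* b := a :* b :* b :* c)
                                            refl (suc h) L (suc n)) ⟩
      (C₂ * suc n) ^ k                 ≡⟨ ^-distribʳ-* k C₂ (suc n) ⟩
      C₂ ^ k * suc n ^ k               ≤⟨ *-monoʳ-≤ (C₂ ^ k) (^-monoʳ-≤ (suc n) (m≤m+n k 1)) ⟩
      C₂ ^ k * suc n ^ (k + 1)         ∎
      where open ≤-Reasoning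

    volume-bound : volume ^ k ≤ C ^ k * suc n ^ (k + 1)
    volume-bound with ≤-total (suc h * (L * suc n) * L) volume | volume ≟ᴺ 0
    ... | inj₂ sparse | _     = ≤-trans (volume-sparse sparse) (*-monoˡ-≤ (suc n ^ (k + 1)) (^-monoˡ-≤ k (m≤n+m C₂ C₁)))
    ... | inj₁ _      | yes 0≡ = subst (λ v → v ^ k ≤ C ^ k * suc n ^ (k + 1)) (sym 0≡) z≤n
    -- `C₁` carries no exponent in `volume-dense`; it is absorbed through `C ≤ C ^ k`.
    ... | inj₁ dense  | no 0≢ = ≤-trans (volume-dense {{≢-nonZero 0≢}} dense)
      (*-monoˡ-≤ (suc n ^ (k + 1)) (≤-trans (m≤m+n C₁ C₂) (m≤m^1+n C (1 + κ))))

  edgeCount-bound : ∀ {n} (G : Graph n) → ¬ H ⊑ G → edgeCount G ^ k ≤ C ^ k * n ^ (k + 1)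
  edgeCount-bound {zero}  G free = z≤n
  edgeCount-bound {suc n} G free = ≤-trans (^-monoˡ-≤ k (edgeCount≤volume G zero)) (volume-bound G free)

  ex-bound : ∀ n → ex n H ^ k ≤ C ^ k * n ^ (k + 1)
  ex-bound n with argmax-sel id 0 (map edgeCount (filter (λ G → ¬? (H ⊑? G)) (allGraphs n)))
  ... | inj₁ ex≡0 = subst (λ e → e ^ k ≤ C ^ k * n ^ (k + 1)) (sym ex≡0) z≤n
  ... | inj₂ ex∈ with ∈-map⁻ edgeCount ex∈
  ...   | G , G∈ , eq = subst (λ e → e ^ k ≤ C ^ k * n ^ (k + 1)) (sym eq)
    (edgeCount-bound G (proj₂ (∈-filter⁻ (λ G → ¬? (H ⊑? G)) {xs = allGraphs n} G∈)))

theorem1p1 : ∀ {h : ℕ} (H : Graph h) →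
    Connected H →
    Bipartite H →
    MinFeedbackVertexNumber H 1 →
    ∀ (k : ℕ) → ShortestCycleLength H (2 * k) →
    (λ n → ex n H) =O[n^ (k + 1) / k ]
theorem1p1 H connected bipartite ((S , acyclic , ∣S∣≡1) , _) k (c , shortest) with k | Cycle.3≤ℓ c | shortest
-- A cycle has at least 3 vertices, so `2 * k` exceeds 2 and `k` is at least 2. The bound holds for
-- every `n`, hence the threshold 0.
... | suc (suc κ) | _ | girth =
  let w , feedback = feedbackVertex H {S} acyclic ∣S∣≡1
  in Bound.C H w connected bipartite feedback κ (girth _) , 0 ,
     λ n _ → Bound.ex-bound H w connected bipartite feedback κ (girth _) n
... | suc zero | s≤s (s≤s ()) | _
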